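{- Let $q=p^e$ with $p$ prime, and let $m\ge4$ be an integer with $(m,q)\neq(4,2)$ and $2\mid em$. Let $\epsilon\in\{1,-1\}$ and $r$ a positive integer, and suppose $D\subsetneq\mathbb{F}_{q^m}^*$ is an $\mathbb{F}_q^*$-invariant partial difference set with parameters $$\big(q^m,\ r(\sqrt{q^m}-\epsilon),\ \epsilon\sqrt{q^m}+r^2-3\epsilon r,\ r^2-\epsilon r\big)$$ (of Latin square type if $\epsilon=1$, negative Latin square type if $\epsilon=-1$). Then the code $\mathcal C(M_D)$ is minimal if one of the following holds: (1) $\epsilon=1$, $r\neq\sqrt{q^m}$ and $r>1$; (2) $\epsilon=-1$, $r\neq\sqrt{q^m}-1$ and $r>\dfrac{(q-1)\sqrt{q^m}}{\sqrt{q^m}+q}$.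
   Context: $\mathrm{Tr}=\mathrm{Tr}_{\mathbb{F}_{q^m}/\mathbb{F}_q}$. $D$ is $\mathbb{F}_q^*$-invariant if $\lambda D=D$ for all $\lambda\in\mathbb{F}_q^*$. A strongly regular graph $(v,k,\lambda,\mu)$ is a simple undirected graph, neither complete nor edgeless, that is $k$-regular on $v$ vertices, where adjacent vertices have exactly $\lambda$ and nonadjacent vertices exactly $\mu$ common neighbours. For $D\subseteq\mathbb{F}_{q^m}^*$ with $-D=D$, $\mathrm{Cay}(\mathbb{F}_{q^m},D)$ has vertex set $\mathbb{F}_{q^m}$ with $x\sim y$ iff $x-y\in D$; $D$ is a partial difference set with parameters $(v,k,\lambda,\mu)$ if this graph is strongly regular with these parameters. Code: fix an ordering $x_1,\dots,x_{q^m-1}$ of $\mathbb{F}_{q^m}^*$, let $f_D$ be the characteristic function of $D$ ($1$ on $D$, $0$ elsewhere, in $\mathbb{F}_q$), and for $(u,v)\in\mathbb{F}_q\times\mathbb{F}_{q^m}$ let $c(u,v)=(uf_D(x_i)+\mathrm{Tr}(vx_i))_{1\le i\le q^m-1}$; $\mathcal C(M_D)=\{c(u,v)\}$. A linear code is minimal if whenever codewords $c,c'$ satisfy $\mathrm{supp}(c')\subseteq\mathrm{supp}(c)$ (supports = sets of nonzero coordinates), $c'=\lambda c$ for some $\lambda\in\mathbb{F}_q$. -}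

module Defs where

open import Level using (0ℓ)
open import Data.Nat as ℕ using (ℕ; zero; suc)
open import Data.Integer as ℤ using (ℤ)
open import Data.List using (List; []; _∷_; length; filter)
open import Data.List.Membership.Propositional using (_∈_)
open import Data.List.Relation.Unary.Unique.Propositional using (Unique)
open import Data.Product using (Σ; _×_; _,_; ∃)
open import Relation.Nullary using (¬_; Dec)
open import Relation.Unary using (Pred)
open import Relation.Binary.PropositionalEquality using (_≡_; _≢_)
open import Relation.Binary.Definitions using (DecidableEquality)
open import Algebra.Structures using (IsCommutativeRing)

record FiniteField : Set₁ where
  infixl 7 _*_
  infixl 6 _+_
  field
    Carrier : Set
    _+_ _*_ : Carrier → Carrier → Carrier
    -_ : Carrier → Carrier
    0# 1# : Carrier
    isCommutativeRing : IsCommutativeRing _≡_ _+_ _*_ -_ 0# 1#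
    0≢1 : 0# ≢ 1#
    inverse : ∀ x → x ≢ 0# → Σ Carrier (λ y → x * y ≡ 1#)
    _≟_ : DecidableEquality Carrier
    elements : List Carrier
    elements-unique : Unique elements
    elements-complete : ∀ x → x ∈ elements

  size : ℕ
  size = length elements

  _^_ : Carrier → ℕ → Carrier
  x ^ zero = 1#
  x ^ suc n = x * (x ^ n)

  sumTo : ℕ → (ℕ → Carrier) → Carrier
  sumTo zero f = 0#
  sumTo (suc n) f = sumTo n f + f n

-- Setting: L = F_{q^m}; the subfield F_q is the set of fixed points of
-- x ↦ x^q (the unique subfield of order q of F_{q^m}).

module Setting (L : FiniteField) (q m : ℕ) where
  open FiniteField L

  InFq : Carrier → Set
  InFq x = x ^ q ≡ x

  Tr : Carrier → Carrier
  Tr x = sumTo m (λ i → x ^ (q ℕ.^ i))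

  count : {P : Pred Carrier 0ℓ} → (∀ x → Dec (P x)) → ℕ
  count P? = length (filter P? elements)

  module _ (D : Pred Carrier 0ℓ) (D? : ∀ x → Dec (D x)) where

    FqInvariant : Set
    FqInvariant = ∀ λ′ → InFq λ′ → λ′ ≢ 0# →
      ∀ x → (D x → D (λ′ * x)) × (D (λ′ * x) → D x)

    Adj : Carrier → Carrier → Set
    Adj x y = D (x + (- y))

    Adj? : ∀ x y → Dec (Adj x y)
    Adj? x y = D? (x + (- y))

    commonNbrs : Carrier → Carrier → ℕ
    commonNbrs x y = count (λ z → Adj? x z Relation.Nullary.×-dec Adj? y z)

    degree : Carrier → ℕ
    degree x = count (λ z → Adj? x z)

    IsSRG : ℤ → ℤ → ℤ → ℤ → Set
    IsSRG v k λ′ μ =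
      (∀ x → ¬ Adj x x) ×
      (∀ x y → Adj x y → Adj y x) ×
      (∃ λ x → ∃ λ y → Adj x y) ×
      (∃ λ x → ∃ λ y → x ≢ y × ¬ Adj x y) ×
      (ℤ.+ size ≡ v) ×
      (∀ x → ℤ.+ degree x ≡ k) ×
      (∀ x y → x ≢ y → Adj x y → ℤ.+ commonNbrs x y ≡ λ′) ×
      (∀ x y → x ≢ y → ¬ Adj x y → ℤ.+ commonNbrs x y ≡ μ)

    IsPDS : ℤ → ℤ → ℤ → ℤ → Set
    IsPDS v k λ′ μ =
      (∀ x → D x → x ≢ 0#) ×
      (∀ x → D x → D (- x)) ×
      IsSRG v k λ′ μ

    fD : Carrier → Carrier
    fD x with D? x
    ... | Relation.Nullary.yes _ = 1#
    ... | Relation.Nullary.no _ = 0#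

    -- codeword c(u,v), coordinates indexed by x ∈ L^*
    cw : Carrier → Carrier → Carrier → Carrier
    cw u v x = u * fD x + Tr (v * x)

    -- the code C(M_D) = { c(u,v) : u ∈ F_q, v ∈ L } is minimal
    IsMinimalCode : Set
    IsMinimalCode =
      ∀ u v u′ v′ → InFq u → InFq u′ →
      (∀ x → x ≢ 0# → cw u′ v′ x ≢ 0# → cw u v x ≢ 0#) →
      Σ Carrier λ c → InFq c × (∀ x → x ≢ 0# → cw u′ v′ x ≡ c * cw u v x)

{-# OPTIONS --safe #-}
module Submission where

-- Let H_v be the kernel of x ↦ Tr(vx), and N₀(v), N₁(v) the numbers of x ∈ D with Tr(vx) = 0 and
-- with Tr(vx) = 1.  Counting the pairs (x , y) ∈ D² with x − y ∈ H_v in two ways gives a quadratic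
-- equation for θ(v) = N₀(v) − N₁(v), whence θ(v) ∈ {−εr , ε(s − r)} for v ≠ 0, where s² = q^m; and
-- q N₀(v) = |D| + (q − 1) θ(v).  This replaces the character sums of D.
--
-- Suppose the zeros of c(u,v) are zeros of c(u′,v′).  If u ≠ 0, subtract a multiple of c(u,v) to reach
-- u′ = 0, and let w be the resulting v′; if w ≠ 0, then D ∩ H_v and D ∩ H_{v+w} differ in size by
-- |H_v ∖ H_w|, which forces θ(w) = |D| − s² (if v = 0), θ(v) − θ(v+w) = q^(m−1) (if v and w are
-- independent) or θ(v) = |D| (if they are proportional).  If u = 0, v ≠ 0 and u′ ≠ 0, then either D
-- misses H_v, so |D| + (q − 1) θ(v) = 0, or q = 2 and θ(v′) + θ(v+v′) = −2^(m−1).  All of these are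
-- excluded by the two possible values of θ.

open import Defs
open import Level using (0ℓ)
open import Data.Nat using (ℕ; zero; suc; _^_; _≤_; _<_; _∸_; z≤n; s≤s)
open import Data.Nat.Divisibility using (_∣_; divides)
open import Data.Nat.Primality using (Prime; euclidsLemma; prime⇒nonTrivial; prime⇒nonZero)
open import Data.Integer using (ℤ; +_; -_; _+_; _*_; _-_; 0ℤ; 1ℤ)
open import Data.Product using (_×_; ∃; Σ; _,_; proj₁; proj₂)
open import Data.Sum using (_⊎_; inj₁; inj₂; [_,_]′)
open import Relation.Nullary using (¬_; Dec; yes; no; contradiction)
open import Relation.Nullary.Decidable using (_×-dec_; ¬?; decidable-stable)
open import Relation.Unary using (Pred)
open import Relation.Binary.PropositionalEquality
  using (_≡_; _≢_; refl; sym; trans; cong; cong₂; subst; module ≡-Reasoning)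

import Algebra.Definitions.RawMonoid as RawMonoidDefs
import Algebra.Properties.CommutativeSemiring.Binomial as Binomial
import Algebra.Properties.CommutativeSemiring.Exp as CommExp
import Algebra.Properties.Ring as RingProps
import Algebra.Properties.Semiring.Exp as SemiringExp
import Algebra.Properties.Semiring.Mult as SemiringMult
import Algebra.Properties.Semiring.Sum as SemiringSum
import Algebra.Solver.Ring.NaturalCoefficients.Default as SemiringSolver
open import Algebra.Bundles using (CommutativeRing; CommutativeMonoid)
open import Algebra.Structures using (IsCommutativeMonoid)
open import Data.Empty using (⊥; ⊥-elim)
open import Data.Fin as Fin using (Fin)
import Data.Fin.Properties as Fin
import Data.Integer as ℤ
import Data.Integer.Properties as ℤ
open import Data.Integer.Solver using (module +-*-Solver)
open import Data.List using (List; []; _∷_; length; foldr; map; filter)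
open import Data.List.Membership.Propositional using (_∈_; lose)
open import Data.List.Membership.Propositional.Properties using (∈-map⁺)
open import Data.List.Membership.Propositional.Properties.WithK using (unique∧set⇒bag)
import Data.List.Properties as List
open import Data.List.Relation.Binary.BagAndSetEquality using (∼bag⇒↭)
open import Data.List.Relation.Binary.Permutation.Propositional using (_↭_; ↭⇒↭ₛ)
import Data.List.Relation.Binary.Permutation.Propositional.Properties as Perm
import Data.List.Relation.Binary.Permutation.Setoid.Properties as SetoidPerm
open import Data.List.Relation.Unary.All as All using (All; []; _∷_)
import Data.List.Relation.Unary.All.Properties as All
open import Data.List.Relation.Unary.AllPairs using ([]; _∷_)
open import Data.List.Relation.Unary.Any as Any using (here; there)
open import Data.List.Relation.Unary.Unique.Propositional using (Unique)
import Data.List.Relation.Unary.Unique.Propositional.Properties as Unique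
open import Data.Nat as ℕ using (_!; NonZero)
open import Data.Nat.Combinatorics using (_C_; nCk≡n!/k![n-k]!; k![n∸k]!∣n!; nCn≡1)
import Data.Nat.Divisibility as Div
import Data.Nat.DivMod as DivMod
import Data.Nat.Properties as ℕ
open import Function.Base using (_∘_)
open import Function.Bundles using (mk⇔)

-- Two features of the setting shape the proof. F_q is given only as the fixed points of x ↦ x^q, so
-- neither its order nor the size of H_v is known at the start; both come from bounding the roots of
-- polynomials. And no count is ever divided: counts are integer sums of indicators, multiplied by q
-- where a fraction would appear, so that each combinatorial identity becomes a ring identity from
-- which q - 1 is cancelled. The bounds on r are read off from the coincidences to be excluded. For
-- v ≠ 0, |D| - θ(v) = q N₁(v) is rs or (r - ε)s; keeping it away from s² and from 0 leads to r ≠ s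
-- and r > 1 for ε = 1, and to r ≠ s - 1 for ε = -1. For ε = -1, q N₀(v) can be r(s + q) - (q - 1)s,
-- which is positive exactly when r exceeds (q - 1)s / (s + q).

-- Binomial coefficients modulo a prime

prime∤! : ∀ {p} → Prime p → ∀ k → k < p → ¬ p ∣ k !
prime∤! {p} pp zero k<p p∣1 =
  contradiction (Div.∣1⇒≡1 p∣1) (ℕ.nonTrivial⇒≢1 {{prime⇒nonTrivial pp}})
prime∤! pp (suc k) k<p p∣ with euclidsLemma (suc k) (k !) pp p∣
... | inj₁ p∣k = Div.>⇒∤ k<p p∣k
... | inj₂ p∣k! = prime∤! pp k (ℕ.<-trans (ℕ.n<1+n k) k<p) p∣k!

-- Multiplied by k! (p - k)! the coefficient becomes p!, which p divides, while p divides neither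
-- factorial of a number below p.
prime∣C : ∀ {p} → Prime p → ∀ k → 0 < k → k < p → p ∣ p C k
prime∣C {p@(suc p-1)} pp k 0<k k<p with euclidsLemma (p C k) (k ! ℕ.* (p ∸ k) !) pp p∣prod
  where
  instance _ = k ℕ.!* (p ∸ k) !≢0
  prod≡ : (p C k) ℕ.* (k ! ℕ.* (p ∸ k) !) ≡ p !
  prod≡ = trans (cong (ℕ._* (k ! ℕ.* (p ∸ k) !)) (nCk≡n!/k![n-k]! (ℕ.<⇒≤ k<p)))
                (DivMod.m/n*n≡m (k![n∸k]!∣n! (ℕ.<⇒≤ k<p)))
  p∣prod : p ∣ (p C k) ℕ.* (k ! ℕ.* (p ∸ k) !)
  p∣prod = subst (p ∣_) (sym prod≡) (Div.m∣m*n (p-1 !))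
... | inj₁ p∣C = p∣C
... | inj₂ p∣k![p-k]! with euclidsLemma (k !) ((p ∸ k) !) pp p∣k![p-k]!
...   | inj₁ p∣k! = contradiction p∣k! (prime∤! pp k k<p)
...   | inj₂ p∣[p-k]! =
        contradiction p∣[p-k]! (prime∤! pp (p ∸ k) (ℕ.∸-monoʳ-< 0<k (ℕ.<⇒≤ k<p)))

-- Sums over a finite field

-- Stated for any commutative monoid because three are needed: field addition, field multiplication
-- and the integers.
module FieldSum (L : FiniteField) {A : Set} {_∙_ : A → A → A} {ε : A}
                (isCM : IsCommutativeMonoid _≡_ _∙_ ε) where
  open FiniteField L using (Carrier; elements; elements-unique; elements-complete; size)
  open IsCommutativeMonoid isCM
    using (identityˡ; identityʳ; assoc; comm)

  private
    M : CommutativeMonoid 0ℓ 0ℓ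
    M = record { isCommutativeMonoid = isCM }
  open RawMonoidDefs (CommutativeMonoid.rawMonoid M) using () renaming (_×_ to _·_)

  interchange : ∀ a b c d → (a ∙ b) ∙ (c ∙ d) ≡ (a ∙ c) ∙ (b ∙ d)
  interchange a b c d = trans (assoc a b _) (trans
    (cong (a ∙_) (trans (sym (assoc b c d)) (trans (cong (_∙ d) (comm b c)) (assoc c b d))))
    (sym (assoc a c _)))

  sumOver : List Carrier → (Carrier → A) → A
  sumOver xs f = foldr _∙_ ε (map f xs)

  ∑ : (Carrier → A) → A
  ∑ = sumOver elements

  sumOver-cong : ∀ xs {f g} → (∀ x → f x ≡ g x) → sumOver xs f ≡ sumOver xs g
  sumOver-cong xs f≗g = cong (foldr _∙_ ε) (List.map-cong f≗g xs)

  ∑-cong : ∀ {f g} → (∀ x → f x ≡ g x) → ∑ f ≡ ∑ g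
  ∑-cong = sumOver-cong elements

  sumOver-∙ : ∀ xs f g → sumOver xs (λ x → f x ∙ g x) ≡ sumOver xs f ∙ sumOver xs g
  sumOver-∙ [] f g = sym (identityˡ ε)
  sumOver-∙ (x ∷ xs) f g = trans (cong ((f x ∙ g x) ∙_) (sumOver-∙ xs f g)) (interchange _ _ _ _)

  ∑-∙ : ∀ f g → ∑ (λ x → f x ∙ g x) ≡ ∑ f ∙ ∑ g
  ∑-∙ = sumOver-∙ elements

  sumOver-const : ∀ xs a → sumOver xs (λ _ → a) ≡ length xs · a
  sumOver-const [] a = refl
  sumOver-const (x ∷ xs) a = cong (a ∙_) (sumOver-const xs a)

  ∑-const : ∀ a → ∑ (λ _ → a) ≡ size · a
  ∑-const = sumOver-const elements

  sumOver-ε : ∀ xs f → All (λ x → f x ≡ ε) xs → sumOver xs f ≡ ε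
  sumOver-ε [] f [] = refl
  sumOver-ε (x ∷ xs) f (fx≡ε ∷ rest) = trans (cong₂ _∙_ fx≡ε (sumOver-ε xs f rest)) (identityˡ ε)

  ∑-ε : ∑ (λ _ → ε) ≡ ε
  ∑-ε = sumOver-ε elements _ (All.universal (λ _ → refl) elements)

  sumOver-single : ∀ xs → Unique xs → ∀ f a → a ∈ xs → (∀ y → y ≢ a → f y ≡ ε) → sumOver xs f ≡ f a
  sumOver-single (x ∷ xs) (x∉xs ∷ _) f a (here refl) off =
    trans (cong (f x ∙_) (sumOver-ε xs f (All.map (λ x≢y → off _ (x≢y ∘ sym)) x∉xs))) (identityʳ _)
  sumOver-single (x ∷ xs) (x∉xs ∷ u) f a (there a∈xs) off =
    trans (cong₂ _∙_ (off x (All.lookup x∉xs a∈xs)) (sumOver-single xs u f a a∈xs off)) (identityˡ _)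

  ∑-single : ∀ f a → (∀ y → y ≢ a → f y ≡ ε) → ∑ f ≡ f a
  ∑-single f a = sumOver-single elements elements-unique f a (elements-complete a)

  sumOver-swap : ∀ xs (f : Carrier → Carrier → A) →
    sumOver xs (λ x → ∑ (f x)) ≡ ∑ (λ y → sumOver xs (λ x → f x y))
  sumOver-swap [] f = sym ∑-ε
  sumOver-swap (x ∷ xs) f = trans (cong (∑ (f x) ∙_) (sumOver-swap xs f)) (sym (∑-∙ _ _))

  ∑-swap : ∀ (f : Carrier → Carrier → A) → ∑ (λ x → ∑ (f x)) ≡ ∑ (λ y → ∑ (λ x → f x y))
  ∑-swap = sumOver-swap elements

  -- A bijection sends the duplicate-free list of all elements to another such list, hence to a
  -- permutation of it, and a commutative fold ignores order.
  ∑-reindex : ∀ (σ τ : Carrier → Carrier) → (∀ x → σ (τ x) ≡ x) → (∀ x → τ (σ x) ≡ x) →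
    ∀ f → ∑ (f ∘ σ) ≡ ∑ f
  ∑-reindex σ τ στ τσ f =
    trans (cong (foldr _∙_ ε) (List.map-∘ elements))
          (SetoidPerm.foldr-commMonoid (CommutativeMonoid.setoid M) isCM
            (↭⇒↭ₛ (Perm.map⁺ f σ-permutes)))
    where
    σ-permutes : map σ elements ↭ elements
    σ-permutes = ∼bag⇒↭ (unique∧set⇒bag
      (Unique.map⁺ (λ {x} {y} eq → trans (sym (τσ x)) (trans (cong τ eq) (τσ y))) elements-unique)
      elements-unique
      (λ {x} → mk⇔ (λ _ → elements-complete x)
                   (λ _ → subst (_∈ map σ elements) (στ x) (∈-map⁺ σ (elements-complete (τ x))))))

-- Frobenius and the root bound

module FieldProperties (L : FiniteField) where
  open FiniteField L renaming
    (_+_ to infixl 6 _⊕_; _*_ to infixl 7 _⊗_; -_ to infix 8 ⊖_; _^_ to infixr 8 _^ᶠ_; _≟_ to infix 4 _≟ᶠ_)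

  R : CommutativeRing 0ℓ 0ℓ
  R = record { isCommutativeRing = isCommutativeRing }

  open CommutativeRing R using
    ( ring; semiring; commutativeSemiring; +-isCommutativeMonoid; *-isCommutativeMonoid
    ; +-identityˡ; +-identityʳ; +-assoc; +-comm; -‿inverseˡ; -‿inverseʳ
    ; *-identityˡ; *-identityʳ; *-assoc; *-comm; distribˡ; distribʳ; zeroˡ; zeroʳ) public
  open RingProps ring public using (-‿distribˡ-*; -‿distribʳ-*; -‿involutive)
  open SemiringMult semiring using (×1-homo-*; ×-assoc-*) renaming (_×_ to _·_)
  open SemiringExp semiring using (^-assocʳ) renaming (_^_ to _^ˢ_)
  open SemiringSum semiring using (sum; sum-init-last; sum-cong-≗; sum-replicate-zero)
  open CommExp commutativeSemiring using (^-distrib-*)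
  open SemiringSolver commutativeSemiring using (solve; _:=_; _:+_; _:*_)

  cancel-⊖ˡ : ∀ a b → ⊖ a ⊕ (a ⊕ b) ≡ b
  cancel-⊖ˡ a b = trans (sym (+-assoc _ a b)) (trans (cong (_⊕ b) (-‿inverseˡ a)) (+-identityˡ b))

  cancel-⊖ʳ : ∀ a b → a ⊕ ⊖ b ⊕ b ≡ a
  cancel-⊖ʳ a b = trans (+-assoc a _ b) (trans (cong (a ⊕_) (-‿inverseˡ b)) (+-identityʳ a))

  cancel-⊖ʳ′ : ∀ a b → a ⊕ b ⊕ ⊖ b ≡ a
  cancel-⊖ʳ′ a b = trans (+-assoc a b _) (trans (cong (a ⊕_) (-‿inverseʳ b)) (+-identityʳ a))

  ⊕-cancelˡ : ∀ a {b c} → a ⊕ b ≡ a ⊕ c → b ≡ c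
  ⊕-cancelˡ a {b} {c} eq = trans (sym (cancel-⊖ˡ a b)) (trans (cong (⊖ a ⊕_) eq) (cancel-⊖ˡ a c))

  a⊕⊖b≡0⇒a≡b : ∀ {a b} → a ⊕ ⊖ b ≡ 0# → a ≡ b
  a⊕⊖b≡0⇒a≡b {a} {b} eq = trans (sym (cancel-⊖ʳ a b)) (trans (cong (_⊕ b) eq) (+-identityˡ b))

  a⊕b≡0⇒b≡⊖a : ∀ {a b} → a ⊕ b ≡ 0# → b ≡ ⊖ a
  a⊕b≡0⇒b≡⊖a {a} eq = ⊕-cancelˡ a (trans eq (sym (-‿inverseʳ a)))

  no-zero-divisors : ∀ {x y} → x ≢ 0# → x ⊗ y ≡ 0# → y ≡ 0#
  no-zero-divisors {x} {y} x≢0 xy≡0 with inverse x x≢0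
  ... | x⁻¹ , xx⁻¹≡1 = begin
    y              ≡⟨ *-identityˡ y ⟨
    1# ⊗ y         ≡⟨ cong (_⊗ y) xx⁻¹≡1 ⟨
    x ⊗ x⁻¹ ⊗ y    ≡⟨ solve 3 (λ x x⁻¹ y → x :* x⁻¹ :* y := x⁻¹ :* (x :* y)) refl x x⁻¹ y ⟩
    x⁻¹ ⊗ (x ⊗ y)  ≡⟨ cong (x⁻¹ ⊗_) xy≡0 ⟩
    x⁻¹ ⊗ 0#       ≡⟨ zeroʳ x⁻¹ ⟩
    0#             ∎
    where open ≡-Reasoning

  ⊗-≢0 : ∀ {x y} → x ≢ 0# → y ≢ 0# → x ⊗ y ≢ 0#
  ⊗-≢0 x≢0 y≢0 xy≡0 = y≢0 (no-zero-divisors x≢0 xy≡0)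

  -- Junk value: 0⁻¹ = 0.
  infix 9 _⁻¹
  _⁻¹ : Carrier → Carrier
  x ⁻¹ with x ≟ᶠ 0#
  ... | yes _ = 0#
  ... | no x≢0 = proj₁ (inverse x x≢0)

  ⁻¹-inverseʳ : ∀ {x} → x ≢ 0# → x ⊗ x ⁻¹ ≡ 1#
  ⁻¹-inverseʳ {x} x≢0 with x ≟ᶠ 0#
  ... | yes x≡0 = contradiction x≡0 x≢0
  ... | no x≢0 = proj₂ (inverse x x≢0)

  ⁻¹-inverseˡ : ∀ {x} → x ≢ 0# → x ⁻¹ ⊗ x ≡ 1#
  ⁻¹-inverseˡ {x} x≢0 = trans (*-comm _ x) (⁻¹-inverseʳ x≢0)

  ⁻¹-≢0 : ∀ {x} → x ≢ 0# → x ⁻¹ ≢ 0#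
  ⁻¹-≢0 {x} x≢0 x⁻¹≡0 = 0≢1 (trans (sym (zeroʳ x)) (trans (cong (x ⊗_) (sym x⁻¹≡0)) (⁻¹-inverseʳ x≢0)))

  ⊗⁻¹-cancel : ∀ {x} y → x ≢ 0# → x ⊗ (x ⁻¹ ⊗ y) ≡ y
  ⊗⁻¹-cancel {x} y x≢0 =
    trans (sym (*-assoc x _ y)) (trans (cong (_⊗ y) (⁻¹-inverseʳ x≢0)) (*-identityˡ y))

  ⁻¹⊗-cancel : ∀ {x} y → x ≢ 0# → x ⁻¹ ⊗ (x ⊗ y) ≡ y
  ⁻¹⊗-cancel {x} y x≢0 =
    trans (sym (*-assoc _ x y)) (trans (cong (_⊗ y) (⁻¹-inverseˡ x≢0)) (*-identityˡ y))

  ^ᶠ≡^ˢ : ∀ x n → x ^ᶠ n ≡ x ^ˢ n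
  ^ᶠ≡^ˢ x zero = refl
  ^ᶠ≡^ˢ x (suc n) = cong (x ⊗_) (^ᶠ≡^ˢ x n)

  ^ᶠ-* : ∀ x m n → (x ^ᶠ m) ^ᶠ n ≡ x ^ᶠ (m ℕ.* n)
  ^ᶠ-* x m n = begin
    (x ^ᶠ m) ^ᶠ n    ≡⟨ ^ᶠ≡^ˢ _ n ⟩
    (x ^ᶠ m) ^ˢ n    ≡⟨ cong (_^ˢ n) (^ᶠ≡^ˢ x m) ⟩
    (x ^ˢ m) ^ˢ n    ≡⟨ ^-assocʳ x m n ⟩
    x ^ˢ (m ℕ.* n)   ≡⟨ ^ᶠ≡^ˢ x (m ℕ.* n) ⟨
    x ^ᶠ (m ℕ.* n)   ∎
    where open ≡-Reasoning

  ^ᶠ-distrib-⊗ : ∀ x y n → (x ⊗ y) ^ᶠ n ≡ x ^ᶠ n ⊗ y ^ᶠ n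
  ^ᶠ-distrib-⊗ x y n = begin
    (x ⊗ y) ^ᶠ n       ≡⟨ ^ᶠ≡^ˢ _ n ⟩
    (x ⊗ y) ^ˢ n       ≡⟨ ^-distrib-* x y n ⟩
    x ^ˢ n ⊗ y ^ˢ n    ≡⟨ cong₂ _⊗_ (^ᶠ≡^ˢ x n) (^ᶠ≡^ˢ y n) ⟨
    x ^ᶠ n ⊗ y ^ᶠ n    ∎
    where open ≡-Reasoning

  1^ᶠ : ∀ n → 1# ^ᶠ n ≡ 1#
  1^ᶠ zero = refl
  1^ᶠ (suc n) = trans (*-identityˡ _) (1^ᶠ n)

  0^ᶠ : ∀ {n} → 1 ≤ n → 0# ^ᶠ n ≡ 0#
  0^ᶠ {suc n} _ = zeroˡ _

  module Sum⊕ = FieldSum L +-isCommutativeMonoid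
  module Prod = FieldSum L *-isCommutativeMonoid

  -- The translation x ↦ x + 1 permutes the field, so adding `1#` to every summand leaves the sum of
  -- all elements unchanged.
  size·1≡0 : size · 1# ≡ 0#
  size·1≡0 = ⊕-cancelˡ (Sum⊕.∑ (λ x → x)) (begin
    ∑ (λ x → x) ⊕ size · 1#          ≡⟨ cong (∑ (λ x → x) ⊕_) (Sum⊕.∑-const 1#) ⟨
    ∑ (λ x → x) ⊕ ∑ (λ _ → 1#)       ≡⟨ Sum⊕.∑-∙ _ _ ⟨
    ∑ (λ x → x ⊕ 1#)                 ≡⟨ Sum⊕.∑-reindex (_⊕ 1#) (_⊕ ⊖ 1#) (λ x → cancel-⊖ʳ x 1#) (λ x → cancel-⊖ʳ′ x 1#)
          (λ x → x) ⟩
    ∑ (λ x → x)                      ≡⟨ +-identityʳ _ ⟨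
    ∑ (λ x → x) ⊕ 0#                 ∎)
    where
    open ≡-Reasoning
    open Sum⊕ using (∑)

  -- For x ≠ 0, multiplication by x permutes the field, so the product of the nonzero elements
  -- equals itself times the product of [x if y ≠ 0, 1 if y = 0] over all y.
  ^size : ∀ x → x ^ᶠ size ≡ x
  ^size x with x ≟ᶠ 0#
  ... | yes refl = 0^ᶠ (nonempty elements (elements-complete 0#))
    where
    nonempty : ∀ xs → 0# ∈ xs → 1 ≤ length xs
    nonempty (_ ∷ _) _ = s≤s z≤n
  ... | no x≢0 = begin
    x ^ᶠ size                  ≡⟨ ^ᶠ≡^ˢ x size ⟩
    x ^ˢ size                  ≡⟨ Prod.∑-const x ⟨
    ∏ (λ _ → x)                ≡⟨ ∏-cong split ⟩
    ∏ (λ y → only x y ⊗ off x y) ≡⟨ ∏-∙ (only x) (off x) ⟩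
    ∏ (only x) ⊗ ∏ (off x)     ≡⟨ cong₂ _⊗_ ∏only ∏off ⟩
    x ⊗ 1#                     ≡⟨ *-identityʳ x ⟩
    x                          ∎
    where
    open ≡-Reasoning
    open Prod using () renaming (∑ to ∏; ∑-cong to ∏-cong; ∑-∙ to ∏-∙; ∑-single to ∏-single; ∑-reindex to ∏-reindex)
    only off : Carrier → Carrier → Carrier
    only a y with y ≟ᶠ 0#
    ... | yes _ = a
    ... | no _ = 1#
    off a y with y ≟ᶠ 0#
    ... | yes _ = 1#
    ... | no _ = a
    nz : Carrier → Carrier
    nz y = off y y
    split : ∀ y → x ≡ only x y ⊗ off x y
    split y with y ≟ᶠ 0#
    ... | yes _ = sym (*-identityʳ x)
    ... | no _ = sym (*-identityˡ x)
    only-off0 : ∀ y → y ≢ 0# → only x y ≡ 1#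
    only-off0 y y≢0 with y ≟ᶠ 0#
    ... | yes y≡0 = contradiction y≡0 y≢0
    ... | no _ = refl
    ∏only : ∏ (only x) ≡ x
    ∏only = trans (∏-single (only x) 0# only-off0) at0
      where
      at0 : only x 0# ≡ x
      at0 with 0# ≟ᶠ 0#
      ... | yes _ = refl
      ... | no 0≢0 = contradiction refl 0≢0
    nz≢0 : ∀ y → nz y ≢ 0#
    nz≢0 y with y ≟ᶠ 0#
    ... | yes _ = λ 1≡0 → 0≢1 (sym 1≡0)
    ... | no y≢0 = y≢0
    ∏≢0 : ∀ xs → Prod.sumOver xs nz ≢ 0#
    ∏≢0 [] = λ 1≡0 → 0≢1 (sym 1≡0)
    ∏≢0 (y ∷ ys) = ⊗-≢0 (nz≢0 y) (∏≢0 ys)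
    nz-scale : ∀ y → nz (x ⊗ y) ≡ nz y ⊗ off x y
    nz-scale y with y ≟ᶠ 0# | x ⊗ y ≟ᶠ 0#
    ... | yes _ | yes _ = sym (*-identityʳ _)
    ... | yes refl | no xy≢0 = contradiction (zeroʳ x) xy≢0
    ... | no y≢0 | yes xy≡0 = contradiction (no-zero-divisors x≢0 xy≡0) y≢0
    ... | no _ | no _ = *-comm x y
    ∏nz-fixed : ∏ nz ⊗ ∏ (off x) ≡ ∏ nz ⊗ 1#
    ∏nz-fixed = begin
      ∏ nz ⊗ ∏ (off x)           ≡⟨ ∏-∙ nz (off x) ⟨
      ∏ (λ y → nz y ⊗ off x y)   ≡⟨ ∏-cong nz-scale ⟨
      ∏ (λ y → nz (x ⊗ y))       ≡⟨ ∏-reindex (x ⊗_) (x ⁻¹ ⊗_) (λ y → ⊗⁻¹-cancel y x≢0) (λ y → ⁻¹⊗-cancel y x≢0) nz ⟩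
      ∏ nz                       ≡⟨ *-identityʳ _ ⟨
      ∏ nz ⊗ 1#                  ∎
    ∏off : ∏ (off x) ≡ 1#
    ∏off = begin
      ∏ (off x)                       ≡⟨ ⁻¹⊗-cancel _ (∏≢0 elements) ⟨
      ∏ nz ⁻¹ ⊗ (∏ nz ⊗ ∏ (off x))    ≡⟨ cong (∏ nz ⁻¹ ⊗_) ∏nz-fixed ⟩
      ∏ nz ⁻¹ ⊗ (∏ nz ⊗ 1#)           ≡⟨ ⁻¹⊗-cancel _ (∏≢0 elements) ⟩
      1#                              ∎

  module Characteristic {p} (prime-p : Prime p) (p·1≡0 : p · 1# ≡ 0#) where

    ∣⇒·≡0 : ∀ {n} x → p ∣ n → n · x ≡ 0#
    ∣⇒·≡0 x (divides c refl) = begin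
      (c ℕ.* p) · x              ≡⟨ cong ((c ℕ.* p) ·_) (*-identityˡ x) ⟨
      (c ℕ.* p) · (1# ⊗ x)       ≡⟨ ×-assoc-* (c ℕ.* p) 1# x ⟨
      ((c ℕ.* p) · 1#) ⊗ x       ≡⟨ cong (_⊗ x) (×1-homo-* c p) ⟩
      (c · 1#) ⊗ (p · 1#) ⊗ x    ≡⟨ cong (λ z → (c · 1#) ⊗ z ⊗ x) p·1≡0 ⟩
      (c · 1#) ⊗ 0# ⊗ x          ≡⟨ cong (_⊗ x) (zeroʳ (c · 1#)) ⟩
      0# ⊗ x                     ≡⟨ zeroˡ x ⟩
      0#                         ∎
      where open ≡-Reasoning

    frobenius-prime : ∀ x y → (x ⊕ y) ^ᶠ p ≡ x ^ᶠ p ⊕ y ^ᶠ p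
    frobenius-prime x y = trans (^ᶠ≡^ˢ _ p) (trans (go p prime-p ∣⇒·≡0)
                          (sym (cong₂ _⊕_ (^ᶠ≡^ˢ x p) (^ᶠ≡^ˢ y p))))
      where
      open ≡-Reasoning
      -- With p abstracted to n, n can be matched as a successor, and the two outer binomial terms
      -- can be split off from the interior ones, which vanish by `prime∣C`.
      go : ∀ n → Prime n → (∀ {k} z → n ∣ k → k · z ≡ 0#) → (x ⊕ y) ^ˢ n ≡ x ^ˢ n ⊕ y ^ˢ n
      go zero pn _ = contradiction refl (ℕ.≢-nonZero⁻¹ 0 {{prime⇒nonZero pn}})
      go n@(suc n-1) pn kill = begin
        (x ⊕ y) ^ˢ n                                  ≡⟨ Binomial.theorem commutativeSemiring n x y ⟩
        sum t                                         ≡⟨⟩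
        t Fin.zero ⊕ sum (t ∘ Fin.suc)                ≡⟨ cong₂ _⊕_ first (sum-init-last (t ∘ Fin.suc)) ⟩
        y ^ˢ n ⊕ (sum (t ∘ Fin.suc ∘ Fin.inject₁) ⊕ t (Fin.fromℕ n))
          ≡⟨ cong (y ^ˢ n ⊕_) (cong₂ _⊕_ (trans (sum-cong-≗ middle) (sum-replicate-zero n-1)) last) ⟩
        y ^ˢ n ⊕ (0# ⊕ x ^ˢ n)                        ≡⟨ cong (y ^ˢ n ⊕_) (+-identityˡ _) ⟩
        y ^ˢ n ⊕ x ^ˢ n                               ≡⟨ +-comm _ _ ⟩
        x ^ˢ n ⊕ y ^ˢ n                               ∎
        where
        t : Fin (suc n) → Carrier
        t = Binomial.binomialTerm commutativeSemiring x y n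
        first : t Fin.zero ≡ y ^ˢ n
        first = trans (+-identityʳ _) (*-identityˡ _)
        last : t (Fin.fromℕ n) ≡ x ^ˢ n
        last rewrite Fin.toℕ-fromℕ n-1 | nCn≡1 n | ℕ.n∸n≡0 n =
          trans (+-identityʳ _) (*-identityʳ _)
        middle : ∀ (i : Fin n-1) → t (Fin.suc (Fin.inject₁ i)) ≡ 0#
        middle i rewrite Fin.toℕ-inject₁ i =
          kill _ (prime∣C pn (suc (Fin.toℕ i)) (s≤s z≤n) (s≤s (Fin.toℕ<n i)))

    frobenius : ∀ e x y → (x ⊕ y) ^ᶠ (p ^ e) ≡ x ^ᶠ (p ^ e) ⊕ y ^ᶠ (p ^ e)
    frobenius zero x y = trans (*-identityʳ _) (sym (cong₂ _⊕_ (*-identityʳ x) (*-identityʳ y)))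
    frobenius (suc e) x y = begin
      (x ⊕ y) ^ᶠ (p ℕ.* p ^ e)                        ≡⟨ ^ᶠ-* _ p (p ^ e) ⟨
      ((x ⊕ y) ^ᶠ p) ^ᶠ (p ^ e)                       ≡⟨ cong (_^ᶠ (p ^ e)) (frobenius-prime x y) ⟩
      (x ^ᶠ p ⊕ y ^ᶠ p) ^ᶠ (p ^ e)                    ≡⟨ frobenius e _ _ ⟩
      (x ^ᶠ p) ^ᶠ (p ^ e) ⊕ (y ^ᶠ p) ^ᶠ (p ^ e)       ≡⟨ cong₂ _⊕_ (^ᶠ-* x p (p ^ e)) (^ᶠ-* y p (p ^ e)) ⟩
      x ^ᶠ (p ℕ.* p ^ e) ⊕ y ^ᶠ (p ℕ.* p ^ e)         ∎
      where open ≡-Reasoning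

  -- The factors p of p^n are stripped one at a time; without zero divisors, either p · 1 vanishes
  -- or the remaining power does, down to 1 = 0.
  characteristic : ∀ p n → size ≡ p ^ n → p · 1# ≡ 0#
  characteristic p n size≡ = go n (trans (cong (_· 1#) (sym size≡)) size·1≡0)
    where
    go : ∀ k → (p ^ k) · 1# ≡ 0# → p · 1# ≡ 0#
    go zero 1·1≡0 = contradiction (trans (sym 1·1≡0) (+-identityʳ 1#)) 0≢1
    go (suc k) eq with p · 1# ≟ᶠ 0#
    ... | yes p≡0 = p≡0
    ... | no p≢0 = go k (no-zero-divisors p≢0 (trans (sym (×1-homo-* p (p ^ k))) eq))

  -- Polynomials appear as functions with a Horner presentation. The degree belongs to the
  -- presentation, not to the function: over a finite field x and x^`size` are the same function.
  data Monic : ℕ → (Carrier → Carrier) → Set where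
    monic-one  : ∀ {f} → (∀ x → f x ≡ 1#) → Monic 0 f
    monic-cons : ∀ {d f} c g → Monic d g → (∀ x → f x ≡ c ⊕ x ⊗ g x) → Monic (suc d) f

  data DegreeBelow : ℕ → (Carrier → Carrier) → Set where
    below-zero : ∀ {d f} → (∀ x → f x ≡ 0#) → DegreeBelow d f
    below-cons : ∀ {d f} c g → DegreeBelow d g → (∀ x → f x ≡ c ⊕ x ⊗ g x) → DegreeBelow (suc d) f

  monic⇒below : ∀ {d d′ f} → d < d′ → Monic d f → DegreeBelow d′ f
  monic⇒below (s≤s d≤d′) (monic-one f≗1) =
    below-cons 1# (λ _ → 0#) (below-zero (λ _ → refl))
      (λ x → trans (f≗1 x) (sym (trans (cong (1# ⊕_) (zeroʳ x)) (+-identityʳ 1#))))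
  monic⇒below (s≤s d<d′) (monic-cons c g mg f≗) = below-cons c g (monic⇒below d<d′ mg) f≗

  monic-power : ∀ d → Monic d (_^ᶠ d)
  monic-power zero = monic-one (λ _ → refl)
  monic-power (suc d) = monic-cons 0# (_^ᶠ d) (monic-power d) (λ x → sym (+-identityˡ _))

  below-⊕-monic : ∀ {d f g} → DegreeBelow d f → Monic d g → Monic d (λ x → f x ⊕ g x)
  below-⊕-monic (below-zero f≗0) (monic-one g≗1) =
    monic-one (λ x → trans (cong₂ _⊕_ (f≗0 x) (g≗1 x)) (+-identityˡ 1#))
  below-⊕-monic (below-zero f≗0) (monic-cons c g′ mg g≗) =
    monic-cons c g′ mg (λ x → trans (cong₂ _⊕_ (f≗0 x) (g≗ x)) (+-identityˡ _))
  below-⊕-monic (below-cons b f′ bf f≗) (monic-cons c g′ mg g≗) =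
    monic-cons (b ⊕ c) (λ x → f′ x ⊕ g′ x) (below-⊕-monic bf mg)
      (λ x → trans (cong₂ _⊕_ (f≗ x) (g≗ x))
        (solve 5 (λ b c x u v → (b :+ x :* u) :+ (c :+ x :* v) := (b :+ c) :+ x :* (u :+ v))
          refl b c x (f′ x) (g′ x)))

  -- Synthetic division: if h is the quotient of g by x - a, then g(a) + x h(x) is the quotient of c
  -- + x g(x).
  factor : ∀ {d f} → Monic (suc d) f → ∀ a →
    ∃ λ g → Monic d g × (∀ x → f x ≡ (x ⊕ ⊖ a) ⊗ g x ⊕ f a)
  factor {f = f} (monic-cons c g (monic-one g≗1) f≗) a = g , monic-one g≗1 , λ x → begin
    f x                                     ≡⟨ f≗ x ⟩
    c ⊕ x ⊗ g x                             ≡⟨ cong (λ z → c ⊕ z ⊗ g x) (cancel-⊖ʳ x a) ⟨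
    c ⊕ (x ⊕ ⊖ a ⊕ a) ⊗ g x                 ≡⟨ solve 4 (λ c e a u → c :+ (e :+ a) :* u := e :* u :+ (c :+ a :* u))
          refl c (x ⊕ ⊖ a) a (g x) ⟩
    (x ⊕ ⊖ a) ⊗ g x ⊕ (c ⊕ a ⊗ g x)         ≡⟨ cong (λ z → (x ⊕ ⊖ a) ⊗ g x ⊕ (c ⊕ a ⊗ z)) (trans (g≗1 x) (sym (g≗1 a))) ⟩
    (x ⊕ ⊖ a) ⊗ g x ⊕ (c ⊕ a ⊗ g a)         ≡⟨ cong ((x ⊕ ⊖ a) ⊗ g x ⊕_) (f≗ a) ⟨
    (x ⊕ ⊖ a) ⊗ g x ⊕ f a                   ∎
    where open ≡-Reasoning
  factor {f = f} (monic-cons c g mg@(monic-cons _ _ _ _) f≗) a with factor mg a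
  ... | h , mh , g≗ = (λ x → g a ⊕ x ⊗ h x) , monic-cons (g a) h mh (λ _ → refl) , λ x → begin
    f x                                                  ≡⟨ f≗ x ⟩
    c ⊕ x ⊗ g x                                          ≡⟨ cong (λ z → c ⊕ x ⊗ z) (g≗ x) ⟩
    c ⊕ x ⊗ ((x ⊕ ⊖ a) ⊗ h x ⊕ g a)                      ≡⟨ solve 5
          (λ c x e u v → c :+ x :* (e :* u :+ v) := e :* (x :* u) :+ (c :+ x :* v)) refl c x (x ⊕ ⊖ a) (h x) (g a) ⟩
    (x ⊕ ⊖ a) ⊗ (x ⊗ h x) ⊕ (c ⊕ x ⊗ g a)                ≡⟨ cong (λ z → (x ⊕ ⊖ a) ⊗ (x ⊗ h x) ⊕ (c ⊕ z ⊗ g a)) (cancel-⊖ʳ x a) ⟨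
    (x ⊕ ⊖ a) ⊗ (x ⊗ h x) ⊕ (c ⊕ (x ⊕ ⊖ a ⊕ a) ⊗ g a)    ≡⟨ solve 5
          (λ c e w a v → e :* w :+ (c :+ (e :+ a) :* v) := e :* (v :+ w) :+ (c :+ a :* v)) refl c (x ⊕ ⊖ a) (x ⊗ h x) a (g a) ⟩
    (x ⊕ ⊖ a) ⊗ (g a ⊕ x ⊗ h x) ⊕ (c ⊕ a ⊗ g a)          ≡⟨ cong ((x ⊕ ⊖ a) ⊗ (g a ⊕ x ⊗ h x) ⊕_) (f≗ a) ⟨
    (x ⊕ ⊖ a) ⊗ (g a ⊕ x ⊗ h x) ⊕ f a                    ∎
    where open ≡-Reasoning

  -- Each root is divided off; the others differ from it, so they remain roots of the cofactor.
  roots≤degree : ∀ {d f} → Monic d f → ∀ {xs} → Unique xs → All (λ x → f x ≡ 0#) xs → length xs ≤ d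
  roots≤degree mf {[]} _ _ = z≤n
  roots≤degree (monic-one f≗1) {x ∷ _} _ (fx≡0 ∷ _) = contradiction (trans (sym fx≡0) (f≗1 x)) 0≢1
  roots≤degree mf@(monic-cons _ _ _ _) {a ∷ xs} (a∉xs ∷ u) (fa≡0 ∷ roots) with factor mf a
  ... | g , mg , f≗ = s≤s (roots≤degree mg u
          (All.zipWith (λ { (a≢x , fx≡0) → no-zero-divisors (λ x-a≡0 → a≢x (sym (a⊕⊖b≡0⇒a≡b x-a≡0)))
             (trans (sym (trans (cong (_ ⊕_) fa≡0) (+-identityʳ _))) (trans (sym (f≗ _)) fx≡0)) })
           (a∉xs , roots)))

-- Counting with integer-valued indicator sums

open +-*-Solver using (solve; _:=_; _:+_; _:*_; _:-_; :-_; con)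

⟦_⟧ : ∀ {P : Set} → Dec P → ℤ
⟦ yes _ ⟧ = 1ℤ
⟦ no _ ⟧ = 0ℤ

⟦⟧-yes : ∀ {P : Set} (P? : Dec P) → P → ⟦ P? ⟧ ≡ 1ℤ
⟦⟧-yes (yes _) p = refl
⟦⟧-yes (no ¬p) p = contradiction p ¬p

⟦⟧-no : ∀ {P : Set} (P? : Dec P) → ¬ P → ⟦ P? ⟧ ≡ 0ℤ
⟦⟧-no (yes p) ¬p = contradiction p ¬p
⟦⟧-no (no _) ¬p = refl

⟦⟧-cong : ∀ {P Q : Set} (P? : Dec P) (Q? : Dec Q) → (P → Q) → (Q → P) → ⟦ P? ⟧ ≡ ⟦ Q? ⟧
⟦⟧-cong (yes p) Q? to from = sym (⟦⟧-yes Q? (to p))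
⟦⟧-cong (no ¬p) Q? to from = sym (⟦⟧-no Q? (¬p ∘ from))

⟦⟧-× : ∀ {P Q : Set} (P? : Dec P) (Q? : Dec Q) → ⟦ P? ×-dec Q? ⟧ ≡ ⟦ P? ⟧ * ⟦ Q? ⟧
⟦⟧-× (yes _) (yes _) = refl
⟦⟧-× (yes _) (no _) = refl
⟦⟧-× (no _) _ = refl

-- Lets an equation that holds only under P be used inside a sum weighted by the indicator of P.
⟦⟧-guard : ∀ {P : Set} (P? : Dec P) {a b} → (P → a ≡ b) → ⟦ P? ⟧ * a ≡ ⟦ P? ⟧ * b
⟦⟧-guard (yes p) eq = cong (1ℤ *_) (eq p)
⟦⟧-guard (no _) {a} {b} eq = trans (ℤ.*-zeroˡ a) (sym (ℤ.*-zeroˡ b))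

module Counting (L : FiniteField) where
  open FiniteField L renaming
    (_+_ to infixl 6 _⊕_; _*_ to infixl 7 _⊗_; -_ to infix 8 ⊖_; _^_ to infixr 8 _^ᶠ_; _≟_ to infix 4 _≟ᶠ_)
  open FieldSum L ℤ.+-0-isCommutativeMonoid public

  search : ∀ {P : Carrier → Set} → (∀ x → Dec (P x)) → ∃ P ⊎ (∀ x → ¬ P x)
  search P? with Any.any? P? elements
  ... | yes found = inj₁ (Any.satisfied found)
  ... | no none = inj₂ (λ x px → none (lose (elements-complete x) px))

  sumOver-*ˡ : ∀ xs c f → sumOver xs (λ x → c * f x) ≡ c * sumOver xs f
  sumOver-*ˡ [] c f = sym (ℤ.*-zeroʳ c)
  sumOver-*ˡ (x ∷ xs) c f = trans (cong (_+_ (c * f x)) (sumOver-*ˡ xs c f)) (sym (ℤ.*-distribˡ-+ c (f x) _))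

  ∑-*ˡ : ∀ c f → ∑ (λ x → c * f x) ≡ c * ∑ f
  ∑-*ˡ = sumOver-*ˡ elements

  ∑-*ʳ : ∀ f c → ∑ (λ x → f x * c) ≡ ∑ f * c
  ∑-*ʳ f c = trans (∑-cong (λ x → ℤ.*-comm (f x) c)) (trans (∑-*ˡ c f) (ℤ.*-comm c _))

  ∑-δ : ∀ (f : Carrier → ℤ) a → ∑ (λ y → ⟦ y ≟ᶠ a ⟧ * f y) ≡ f a
  ∑-δ f a = trans
    (∑-single _ a (λ y y≢a → trans (cong (_* f y) (⟦⟧-no (y ≟ᶠ a) y≢a)) (ℤ.*-zeroˡ (f y))))
    (trans (cong (_* f a) (⟦⟧-yes (a ≟ᶠ a) refl)) (ℤ.*-identityˡ (f a)))

  sumOver-⟦⟧ : ∀ xs {P : Pred Carrier 0ℓ} (P? : ∀ x → Dec (P x)) →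
    + length (filter P? xs) ≡ sumOver xs (λ x → ⟦ P? x ⟧)
  sumOver-⟦⟧ [] P? = refl
  sumOver-⟦⟧ (x ∷ xs) P? with P? x
  ... | yes _ = cong (_+_ 1ℤ) (sumOver-⟦⟧ xs P?)
  ... | no _ = trans (sumOver-⟦⟧ xs P?) (sym (ℤ.+-identityˡ _))

  ∑-⟦⟧ : ∀ {P : Pred Carrier 0ℓ} (P? : ∀ x → Dec (P x)) → + length (filter P? elements) ≡ ∑ (λ x → ⟦ P? x ⟧)
  ∑-⟦⟧ = sumOver-⟦⟧ elements

  ∑-1 : ∑ (λ _ → 1ℤ) ≡ + size
  ∑-1 = go elements
    where
    go : ∀ xs → sumOver xs (λ _ → 1ℤ) ≡ + length xs
    go [] = refl
    go (x ∷ xs) = cong (_+_ 1ℤ) (go xs)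

  ∑-≥0 : ∀ {f} → (∀ x → 0ℤ ℤ.≤ f x) → 0ℤ ℤ.≤ ∑ f
  ∑-≥0 {f} f≥0 = go elements
    where
    go : ∀ xs → 0ℤ ℤ.≤ sumOver xs f
    go [] = ℤ.≤-refl
    go (x ∷ xs) = ℤ.+-mono-≤ (f≥0 x) (go xs)

-- The trace form

module Trace (L : FiniteField) (q m-1 : ℕ) (2≤q : 2 ≤ q)
    (size≡ : FiniteField.size L ≡ q ^ suc m-1)
    (frob : ∀ x y → FiniteField._^_ L (FiniteField._+_ L x y) q
                    ≡ FiniteField._+_ L (FiniteField._^_ L x q) (FiniteField._^_ L y q)) where
  open FiniteField L renaming
    (_+_ to infixl 6 _⊕_; _*_ to infixl 7 _⊗_; -_ to infix 8 ⊖_; _^_ to infixr 8 _^ᶠ_; _≟_ to infix 4 _≟ᶠ_)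
  open FieldProperties L
  open Counting L
  m : ℕ
  m = suc m-1
  open Setting L q m using (InFq; Tr; count)

  InFq? : ∀ x → Dec (InFq x)
  InFq? x = x ^ᶠ q ≟ᶠ x

  InFq-0 : InFq 0#
  InFq-0 = 0^ᶠ (ℕ.<⇒≤ 2≤q)

  InFq-1 : InFq 1#
  InFq-1 = 1^ᶠ q

  InFq-⊗ : ∀ {x y} → InFq x → InFq y → InFq (x ⊗ y)
  InFq-⊗ x∈ y∈ = trans (^ᶠ-distrib-⊗ _ _ q) (cong₂ _⊗_ x∈ y∈)

  -- Additivity of the q-th power at x + (-x) = 0 avoids a distinction on the parity of q.
  InFq-⊖ : ∀ {x} → InFq x → InFq (⊖ x)
  InFq-⊖ {x} x∈ = a⊕b≡0⇒b≡⊖a (begin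
    x ⊕ (⊖ x) ^ᶠ q           ≡⟨ cong (_⊕ (⊖ x) ^ᶠ q) x∈ ⟨
    x ^ᶠ q ⊕ (⊖ x) ^ᶠ q      ≡⟨ frob x (⊖ x) ⟨
    (x ⊕ ⊖ x) ^ᶠ q           ≡⟨ cong (_^ᶠ q) (-‿inverseʳ x) ⟩
    0# ^ᶠ q                  ≡⟨ InFq-0 ⟩
    0#                       ∎)
    where open ≡-Reasoning

  InFq-⁻¹ : ∀ {x} → x ≢ 0# → InFq x → InFq (x ⁻¹)
  InFq-⁻¹ {x} x≢0 x∈ = begin
    x ⁻¹ ^ᶠ q                      ≡⟨ ⁻¹⊗-cancel _ x≢0 ⟨
    x ⁻¹ ⊗ (x ⊗ x ⁻¹ ^ᶠ q)         ≡⟨ cong (λ z → x ⁻¹ ⊗ (z ⊗ x ⁻¹ ^ᶠ q)) x∈ ⟨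
    x ⁻¹ ⊗ (x ^ᶠ q ⊗ x ⁻¹ ^ᶠ q)    ≡⟨ cong (x ⁻¹ ⊗_) (^ᶠ-distrib-⊗ x (x ⁻¹) q) ⟨
    x ⁻¹ ⊗ (x ⊗ x ⁻¹) ^ᶠ q         ≡⟨ cong (λ z → x ⁻¹ ⊗ z ^ᶠ q) (⁻¹-inverseʳ x≢0) ⟩
    x ⁻¹ ⊗ 1# ^ᶠ q                 ≡⟨ cong (x ⁻¹ ⊗_) InFq-1 ⟩
    x ⁻¹ ⊗ 1#                      ≡⟨ *-identityʳ _ ⟩
    x ⁻¹                           ∎
    where open ≡-Reasoning

  ^ᶠ-suc : ∀ x i → x ^ᶠ (q ^ suc i) ≡ (x ^ᶠ (q ^ i)) ^ᶠ q
  ^ᶠ-suc x i = trans (cong (x ^ᶠ_) (ℕ.*-comm q (q ^ i))) (sym (^ᶠ-* x (q ^ i) q))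

  frobⁱ : ∀ i x y → (x ⊕ y) ^ᶠ (q ^ i) ≡ x ^ᶠ (q ^ i) ⊕ y ^ᶠ (q ^ i)
  frobⁱ zero x y = trans (*-identityʳ _) (sym (cong₂ _⊕_ (*-identityʳ x) (*-identityʳ y)))
  frobⁱ (suc i) x y = begin
    (x ⊕ y) ^ᶠ (q ^ suc i)                        ≡⟨ ^ᶠ-suc _ i ⟩
    ((x ⊕ y) ^ᶠ (q ^ i)) ^ᶠ q                     ≡⟨ cong (_^ᶠ q) (frobⁱ i x y) ⟩
    (x ^ᶠ (q ^ i) ⊕ y ^ᶠ (q ^ i)) ^ᶠ q            ≡⟨ frob _ _ ⟩
    (x ^ᶠ (q ^ i)) ^ᶠ q ⊕ (y ^ᶠ (q ^ i)) ^ᶠ q     ≡⟨ cong₂ _⊕_ (^ᶠ-suc x i) (^ᶠ-suc y i) ⟨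
    x ^ᶠ (q ^ suc i) ⊕ y ^ᶠ (q ^ suc i)           ∎
    where open ≡-Reasoning

  InFq-fixedⁱ : ∀ {c} → InFq c → ∀ i → c ^ᶠ (q ^ i) ≡ c
  InFq-fixedⁱ c∈ zero = *-identityʳ _
  InFq-fixedⁱ c∈ (suc i) = trans (^ᶠ-suc _ i) (trans (cong (_^ᶠ q) (InFq-fixedⁱ c∈ i)) c∈)

  sumTo-cong : ∀ n {f g} → (∀ i → f i ≡ g i) → sumTo n f ≡ sumTo n g
  sumTo-cong zero eq = refl
  sumTo-cong (suc n) eq = cong₂ _⊕_ (sumTo-cong n eq) (eq n)

  sumTo-⊕ : ∀ n f g → sumTo n (λ i → f i ⊕ g i) ≡ sumTo n f ⊕ sumTo n g
  sumTo-⊕ zero f g = sym (+-identityˡ 0#)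
  sumTo-⊕ (suc n) f g = trans (cong (_⊕ (f n ⊕ g n)) (sumTo-⊕ n f g)) (Sum⊕.interchange _ _ _ _)

  sumTo-⊗ : ∀ n c f → sumTo n (λ i → c ⊗ f i) ≡ c ⊗ sumTo n f
  sumTo-⊗ zero c f = sym (zeroʳ c)
  sumTo-⊗ (suc n) c f = trans (cong (_⊕ c ⊗ f n) (sumTo-⊗ n c f)) (sym (distribˡ c _ _))

  sumTo-^q : ∀ n f → sumTo n f ^ᶠ q ≡ sumTo n (λ i → f i ^ᶠ q)
  sumTo-^q zero f = InFq-0
  sumTo-^q (suc n) f = trans (frob _ _) (cong (_⊕ f n ^ᶠ q) (sumTo-^q n f))

  sumTo-shift : ∀ n f → f 0 ⊕ sumTo n (f ∘ suc) ≡ sumTo n f ⊕ f n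
  sumTo-shift zero f = +-comm _ _
  sumTo-shift (suc n) f = trans (sym (+-assoc _ _ _)) (cong (_⊕ f (suc n)) (sumTo-shift n f))

  Tr-⊕ : ∀ x y → Tr (x ⊕ y) ≡ Tr x ⊕ Tr y
  Tr-⊕ x y = trans (sumTo-cong m (λ i → frobⁱ i x y)) (sumTo-⊕ m _ _)

  Tr-⊗ : ∀ {c} x → InFq c → Tr (c ⊗ x) ≡ c ⊗ Tr x
  Tr-⊗ {c} x c∈ = trans
    (sumTo-cong m (λ i → trans (^ᶠ-distrib-⊗ c x (q ^ i)) (cong (_⊗ x ^ᶠ (q ^ i)) (InFq-fixedⁱ c∈ i))))
    (sumTo-⊗ m c _)

  Tr-0 : Tr 0# ≡ 0#
  Tr-0 = ⊕-cancelˡ (Tr 0#) (trans (sym (Tr-⊕ 0# 0#)) (trans (cong Tr (+-identityˡ 0#)) (sym (+-identityʳ _))))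

  -- Raising to the q-th power shifts the summands by one place, and x^(q^m) = x closes the cycle.
  -- The extra summand x on both sides replaces a subtraction.
  Tr-InFq : ∀ x → InFq (Tr x)
  Tr-InFq x = ⊕-cancelˡ x (begin
    x ⊕ Tr x ^ᶠ q                                  ≡⟨ cong (x ⊕_) (sumTo-^q m (λ i → x ^ᶠ (q ^ i))) ⟩
    x ⊕ sumTo m (λ i → (x ^ᶠ (q ^ i)) ^ᶠ q)        ≡⟨ cong₂ _⊕_ (*-identityʳ x) (sumTo-cong m (^ᶠ-suc x)) ⟨
    x ^ᶠ (q ^ 0) ⊕ sumTo m (λ i → x ^ᶠ (q ^ suc i)) ≡⟨ sumTo-shift m (λ i → x ^ᶠ (q ^ i)) ⟩
    Tr x ⊕ x ^ᶠ (q ^ m)                            ≡⟨ cong (Tr x ⊕_) (trans (cong (x ^ᶠ_) (sym size≡)) (^size x)) ⟩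
    Tr x ⊕ x                                       ≡⟨ +-comm _ _ ⟩
    x ⊕ Tr x                                       ∎)
    where open ≡-Reasoning

  q^i<q^[1+i] : ∀ i → q ^ i < q ^ suc i
  q^i<q^[1+i] i = ℕ.^-monoʳ-< q 2≤q (ℕ.n<1+n i)

  -- The exponents q^i increase strictly, so the last summand is the leading term and the earlier
  -- ones form the lower-order part; hence the mutual recursion.
  sumTo-below : ∀ n → DegreeBelow (q ^ n) (λ x → sumTo n (λ i → x ^ᶠ (q ^ i)))
  sumTo-monic : ∀ n → Monic (q ^ n) (λ x → sumTo (suc n) (λ i → x ^ᶠ (q ^ i)))
  sumTo-below zero = below-zero (λ _ → refl)
  sumTo-below (suc n) = monic⇒below (q^i<q^[1+i] n) (sumTo-monic n)
  sumTo-monic n = below-⊕-monic (sumTo-below n) (monic-power (q ^ n))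

  count-roots : ∀ {d f} → Monic d f → {P : Pred Carrier 0ℓ} (P? : ∀ x → Dec (P x)) →
    (∀ {x} → P x → f x ≡ 0#) → count P? ≤ d
  count-roots mf P? root = roots≤degree mf (Unique.filter⁺ P? elements-unique) (All.map root (All.all-filter P? elements))

  |Fq|≤q : count InFq? ≤ q
  |Fq|≤q = count-roots (below-⊕-monic (below 2≤q) (monic-power q)) InFq?
    (λ {x} x∈ → trans (cong (⊖ x ⊕_) x∈) (-‿inverseˡ x))
    where
    -- The lower-order part of x^q - x is -x = 0 + x (-1 + x · 0): two Horner steps, whence the need
    -- for q ≥ 2.
    below : ∀ {d} → 2 ≤ d → DegreeBelow d ⊖_
    below (s≤s (s≤s _)) = below-cons 0# (λ _ → ⊖ 1#)
      (below-cons (⊖ 1#) (λ _ → 0#) (below-zero (λ _ → refl))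
        (λ x → sym (trans (cong (⊖ 1# ⊕_) (zeroʳ x)) (+-identityʳ _))))
      (λ x → sym (trans (+-identityˡ _) (trans (sym (-‿distribʳ-* x 1#)) (cong ⊖_ (*-identityʳ x)))))

  |kerTr|≤ : count (λ x → Tr x ≟ᶠ 0#) ≤ q ^ m-1
  |kerTr|≤ = count-roots (sumTo-monic m-1) (λ x → Tr x ≟ᶠ 0#) (λ eq → eq)

  -- An identically vanishing trace would give a polynomial of degree q^(m-1) all q^m elements as
  -- roots. A nonzero value lies in F_q, so linearity rescales it to 1.
  Tr-onto : ∃ λ x → Tr x ≡ 1#
  Tr-onto with search {P = λ x → Tr x ≢ 0#} (λ x → ¬? (Tr x ≟ᶠ 0#))
  ... | inj₁ (x , Tr≢0) =
        Tr x ⁻¹ ⊗ x , trans (Tr-⊗ x (InFq-⁻¹ Tr≢0 (Tr-InFq x))) (⁻¹-inverseˡ Tr≢0)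
  ... | inj₂ all-zero = contradiction
        (roots≤degree (sumTo-monic m-1) elements-unique (All.universal (λ x → decidable-stable
              (Tr x ≟ᶠ 0#) (all-zero x)) elements))
        (ℕ.<⇒≱ (subst (q ^ m-1 <_) (sym size≡) (q^i<q^[1+i] m-1)))

  Tr-onto′ : ∀ {v} → v ≢ 0# → ∃ λ x → Tr (v ⊗ x) ≡ 1#
  Tr-onto′ {v} v≢0 with Tr-onto
  ... | x , Tr≡1 = v ⁻¹ ⊗ x , trans (cong Tr (⊗⁻¹-cancel x v≢0)) Tr≡1

  trace-nondegenerate : ∀ {v} → (∀ x → Tr (v ⊗ x) ≡ 0#) → v ≡ 0#
  trace-nondegenerate {v} vanish with v ≟ᶠ 0#
  ... | yes v≡0 = v≡0
  ... | no v≢0 with Tr-onto′ v≢0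
  ...   | x , Tr≡1 = contradiction (trans (sym (vanish x)) Tr≡1) 0≢1

  Tr-linear : ∀ v x c y → InFq c → Tr (v ⊗ (x ⊕ c ⊗ y)) ≡ Tr (v ⊗ x) ⊕ c ⊗ Tr (v ⊗ y)
  Tr-linear v x c y c∈ = begin
    Tr (v ⊗ (x ⊕ c ⊗ y))               ≡⟨ cong Tr (distribˡ v x _) ⟩
    Tr (v ⊗ x ⊕ v ⊗ (c ⊗ y))           ≡⟨ Tr-⊕ _ _ ⟩
    Tr (v ⊗ x) ⊕ Tr (v ⊗ (c ⊗ y))      ≡⟨ cong (λ z → Tr (v ⊗ x) ⊕ Tr z) (⊗-exchange v c y) ⟩
    Tr (v ⊗ x) ⊕ Tr (c ⊗ (v ⊗ y))      ≡⟨ cong (Tr (v ⊗ x) ⊕_) (Tr-⊗ _ c∈) ⟩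
    Tr (v ⊗ x) ⊕ c ⊗ Tr (v ⊗ y)        ∎
    where
    open ≡-Reasoning
    ⊗-exchange : ∀ a b c → a ⊗ (b ⊗ c) ≡ b ⊗ (a ⊗ c)
    ⊗-exchange a b c = trans (sym (*-assoc a b c)) (trans (cong (_⊗ c) (*-comm a b)) (*-assoc b a c))

  Tr-scale : ∀ v c x → InFq c → Tr (v ⊗ (c ⊗ x)) ≡ c ⊗ Tr (v ⊗ x)
  Tr-scale v c x c∈ = begin
    Tr (v ⊗ (c ⊗ x))              ≡⟨ cong (λ z → Tr (v ⊗ z)) (+-identityˡ _) ⟨
    Tr (v ⊗ (0# ⊕ c ⊗ x))         ≡⟨ Tr-linear v 0# c x c∈ ⟩
    Tr (v ⊗ 0#) ⊕ c ⊗ Tr (v ⊗ x)  ≡⟨ cong (_⊕ c ⊗ Tr (v ⊗ x)) (trans (cong Tr (zeroʳ v)) Tr-0) ⟩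
    0# ⊕ c ⊗ Tr (v ⊗ x)           ≡⟨ +-identityˡ _ ⟩
    c ⊗ Tr (v ⊗ x)                ∎
    where open ≡-Reasoning

  Tr-⊕ˡ : ∀ v w x → Tr ((v ⊕ w) ⊗ x) ≡ Tr (v ⊗ x) ⊕ Tr (w ⊗ x)
  Tr-⊕ˡ v w x = trans (cong Tr (distribʳ x v w)) (Tr-⊕ _ _)

  Tr-⊗ˡ : ∀ c v x → InFq c → Tr (c ⊗ v ⊗ x) ≡ c ⊗ Tr (v ⊗ x)
  Tr-⊗ˡ c v x c∈ = trans (cong Tr (*-assoc c v x)) (Tr-⊗ _ c∈)

  -- If Tr(v x₀) = 1, then x - Tr(vx) x₀ lies in the kernel of v, hence of w. With c = Tr(w x₀) this
  -- says that Tr((w - cv) x) = 0 for all x.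
  proportional : ∀ {v w} → v ≢ 0# → (∀ x → Tr (v ⊗ x) ≡ 0# → Tr (w ⊗ x) ≡ 0#) →
    ∃ λ c → InFq c × w ≡ c ⊗ v
  proportional {v} {w} v≢0 ker⊆ with Tr-onto′ v≢0
  ... | x₀ , Tr≡1 = c , c∈ , a⊕⊖b≡0⇒a≡b (trace-nondegenerate (λ x → begin
    Tr ((w ⊕ ⊖ (c ⊗ v)) ⊗ x)                  ≡⟨ cong (λ z → Tr ((w ⊕ z) ⊗ x)) (-‿distribˡ-* c v) ⟩
    Tr ((w ⊕ ⊖ c ⊗ v) ⊗ x)                    ≡⟨ Tr-⊕ˡ w _ x ⟩
    Tr (w ⊗ x) ⊕ Tr (⊖ c ⊗ v ⊗ x)             ≡⟨ cong (Tr (w ⊗ x) ⊕_) (Tr-⊗ˡ (⊖ c) v x (InFq-⊖ c∈)) ⟩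
    Tr (w ⊗ x) ⊕ ⊖ c ⊗ t x                    ≡⟨ cong (Tr (w ⊗ x) ⊕_) (swap-sign c (t x)) ⟩
    Tr (w ⊗ x) ⊕ ⊖ t x ⊗ c                    ≡⟨ Tr-linear w x (⊖ t x) x₀ (InFq-⊖ (Tr-InFq _)) ⟨
    Tr (w ⊗ (x ⊕ ⊖ t x ⊗ x₀))                 ≡⟨ ker⊆ _ (in-kernel x) ⟩
    0#                                        ∎))
    where
    open ≡-Reasoning
    c : Carrier
    c = Tr (w ⊗ x₀)
    c∈ : InFq c
    c∈ = Tr-InFq _
    t : Carrier → Carrier
    t x = Tr (v ⊗ x)
    swap-sign : ∀ a b → ⊖ a ⊗ b ≡ ⊖ b ⊗ a
    swap-sign a b = trans (sym (-‿distribˡ-* a b)) (trans (cong ⊖_ (*-comm a b)) (-‿distribˡ-* b a))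
    in-kernel : ∀ x → Tr (v ⊗ (x ⊕ ⊖ t x ⊗ x₀)) ≡ 0#
    in-kernel x = begin
      Tr (v ⊗ (x ⊕ ⊖ t x ⊗ x₀))      ≡⟨ Tr-linear v x (⊖ t x) x₀ (InFq-⊖ (Tr-InFq _)) ⟩
      t x ⊕ ⊖ t x ⊗ Tr (v ⊗ x₀)      ≡⟨ cong (λ z → t x ⊕ ⊖ t x ⊗ z) Tr≡1 ⟩
      t x ⊕ ⊖ t x ⊗ 1#               ≡⟨ cong (t x ⊕_) (*-identityʳ _) ⟩
      t x ⊕ ⊖ t x                    ≡⟨ -‿inverseʳ (t x) ⟩
      0#                             ∎

  φ : Carrier → ℤ
  φ a = ⟦ InFq? a ⟧

  ∑φ-fibre : ∀ {b} → InFq b → ∑ (λ a → φ a * ⟦ a ≟ᶠ b ⟧) ≡ 1ℤ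
  ∑φ-fibre {b} b∈ = trans (∑-cong (λ a → ℤ.*-comm (φ a) _)) (trans (∑-δ φ b) (⟦⟧-yes (InFq? b) b∈))

  fibrewise : ∀ (S : Carrier → ℤ) (h : Carrier → Carrier) → (∀ x → InFq (h x)) →
    ∑ S ≡ ∑ (λ a → φ a * ∑ (λ x → S x * ⟦ a ≟ᶠ h x ⟧))
  fibrewise S h h∈ = begin
    ∑ S
      ≡⟨ ∑-cong (λ x → trans (sym (ℤ.*-identityʳ (S x))) (cong (S x *_) (sym (∑φ-fibre (h∈ x))))) ⟩
    ∑ (λ x → S x * ∑ (λ a → φ a * ⟦ a ≟ᶠ h x ⟧))
      ≡⟨ ∑-cong (λ x → sym (∑-*ˡ (S x) _)) ⟩
    ∑ (λ x → ∑ (λ a → S x * (φ a * ⟦ a ≟ᶠ h x ⟧)))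
      ≡⟨ ∑-swap _ ⟩
    ∑ (λ a → ∑ (λ x → S x * (φ a * ⟦ a ≟ᶠ h x ⟧)))
      ≡⟨ ∑-cong (λ a → trans (∑-cong (λ x → ℤ-exchange (S x) (φ a) _)) (∑-*ˡ (φ a) _)) ⟩
    ∑ (λ a → φ a * ∑ (λ x → S x * ⟦ a ≟ᶠ h x ⟧))  ∎
    where
    open ≡-Reasoning
    ℤ-exchange : ∀ a b c → a * (b * c) ≡ b * (a * c)
    ℤ-exchange = solve 3 (λ a b c → a :* (b :* c) := b :* (a :* c)) refl

  -- Translation by a x₀ carries the fibre of h over 0 to the fibre over a and preserves the weight
  -- S, so all fibres over F_q have equal weight.
  equidistribution : ∀ (S : Carrier → ℤ) (h : Carrier → Carrier) → (∀ x → InFq (h x)) → ∀ x₀ →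
    (∀ {c} x → InFq c → S (x ⊕ c ⊗ x₀) ≡ S x) →
    (∀ {c} x → InFq c → h (x ⊕ c ⊗ x₀) ≡ h x ⊕ c) →
    ∑ S ≡ ∑ φ * ∑ (λ x → S x * ⟦ h x ≟ᶠ 0# ⟧)
  equidistribution S h h∈ x₀ S-inv h-shift = begin
    ∑ S                                                     ≡⟨ fibrewise S h h∈ ⟩
    ∑ (λ a → φ a * ∑ (λ x → S x * ⟦ a ≟ᶠ h x ⟧))            ≡⟨ ∑-cong (λ a → ⟦⟧-guard (InFq? a) (same a)) ⟩
    ∑ (λ a → φ a * ∑ (λ x → S x * ⟦ h x ≟ᶠ 0# ⟧))           ≡⟨ ∑-*ʳ φ _ ⟩
    ∑ φ * ∑ (λ x → S x * ⟦ h x ≟ᶠ 0# ⟧)                     ∎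
    where
    open ≡-Reasoning
    same : ∀ a → InFq a → ∑ (λ x → S x * ⟦ a ≟ᶠ h x ⟧) ≡ ∑ (λ x → S x * ⟦ h x ≟ᶠ 0# ⟧)
    same a a∈ = begin
      ∑ (λ x → S x * ⟦ a ≟ᶠ h x ⟧)
        ≡⟨ ∑-reindex (_⊕ a ⊗ x₀) (_⊕ ⊖ (a ⊗ x₀)) (λ x → cancel-⊖ʳ x _) (λ x → cancel-⊖ʳ′ x _) _ ⟨
      ∑ (λ x → S (x ⊕ a ⊗ x₀) * ⟦ a ≟ᶠ h (x ⊕ a ⊗ x₀) ⟧)
        ≡⟨ ∑-cong (λ x → cong₂ _*_ (S-inv x a∈) (⟦⟧-cong (a ≟ᶠ _) (h x ≟ᶠ 0#)
             (λ eq → ⊕-cancelˡ a (trans (+-comm a _) (trans (sym (h-shift x a∈)) (trans (sym eq) (sym (+-identityʳ a))))))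
             (λ eq → sym (trans (h-shift x a∈) (trans (cong (_⊕ a) eq) (+-identityˡ a)))))) ⟩
      ∑ (λ x → S x * ⟦ h x ≟ᶠ 0# ⟧)  ∎

  Z : Carrier → Carrier → ℤ
  Z v x = ⟦ Tr (v ⊗ x) ≟ᶠ 0# ⟧

  ∑-equidistributed : ∀ {v} → v ≢ 0# → + size ≡ ∑ φ * ∑ (Z v)
  ∑-equidistributed {v} v≢0 with Tr-onto′ v≢0
  ... | x₀ , Tr≡1 = trans (sym ∑-1) (trans
    (equidistribution (λ _ → 1ℤ) (λ x → Tr (v ⊗ x)) (λ x → Tr-InFq _) x₀ (λ _ _ → refl)
      (λ {c} x c∈ → trans (Tr-linear v x c x₀ c∈) (cong (Tr (v ⊗ x) ⊕_) (trans (cong (c ⊗_) Tr≡1) (*-identityʳ c)))))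
    (cong (∑ φ *_) (∑-cong (λ x → ℤ.*-identityˡ (Z v x)))))

  -- |F_q| ≤ q and |ker Tr| ≤ q^(m-1), while their product is q^m.
  ∑φ≡q : ∑ φ ≡ + q
  ∑φ≡q = trans (sym (∑-⟦⟧ InFq?)) (cong +_ (ℕ.≤-antisym |Fq|≤q
    (ℕ.*-cancelʳ-≤ q (count InFq?) (q ^ m-1) {{ℕ.m^n≢0 q m-1 {{ℕ.>-nonZero (ℕ.<⇒≤ 2≤q)}}}} (begin
      q ^ m                                     ≡⟨ size≡ ⟨
      size                                      ≡⟨ ℤ.+-injective product ⟩
      count InFq? ℕ.* count (λ x → Tr x ≟ᶠ 0#)  ≤⟨ ℕ.*-monoʳ-≤ (count InFq?) |kerTr|≤ ⟩
      count InFq? ℕ.* q ^ m-1                   ∎))))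
    where
    open ℕ.≤-Reasoning
    product : + size ≡ + (count InFq? ℕ.* count (λ x → Tr x ≟ᶠ 0#))
    product = trans (∑-equidistributed {1#} (0≢1 ∘ sym)) (trans
      (cong₂ _*_ (sym (∑-⟦⟧ InFq?))
        (trans (∑-cong (λ x → ⟦⟧-cong (Tr (1# ⊗ x) ≟ᶠ 0#) (Tr x ≟ᶠ 0#)
                  (trans (cong Tr (sym (*-identityˡ x)))) (trans (cong Tr (*-identityˡ x)))))
               (sym (∑-⟦⟧ (λ x → Tr x ≟ᶠ 0#)))))
      (sym (ℤ.pos-* (count InFq?) _)))

  |hyperplane| : ∀ {v} → v ≢ 0# → + q * ∑ (Z v) ≡ + (q ^ m)
  |hyperplane| v≢0 = trans (cong (_* ∑ (Z _)) (sym ∑φ≡q)) (trans (sym (∑-equidistributed v≢0)) (cong +_ size≡))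

  -- Rescaling x₁ by an element of F_q gives x₀ in H_v with Tr(w x₀) = 1. Translations by multiples
  -- of x₀ preserve H_v and permute its fibres under x ↦ Tr(wx) transitively.
  |hyperplane∩| : ∀ {v w x₁} → Tr (v ⊗ x₁) ≡ 0# → Tr (w ⊗ x₁) ≢ 0# →
    ∑ (Z v) ≡ + q * ∑ (λ x → Z v x * Z w x)
  |hyperplane∩| {v} {w} {x₁} Trv≡0 Trw≢0 = trans
    (equidistribution (Z v) (λ x → Tr (w ⊗ x)) (λ x → Tr-InFq _) x₀ Z-inv shift)
    (cong (_* ∑ (λ x → Z v x * Z w x)) ∑φ≡q)
    where
    b∈ : InFq (Tr (w ⊗ x₁) ⁻¹)
    b∈ = InFq-⁻¹ Trw≢0 (Tr-InFq _)
    x₀ : Carrier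
    x₀ = Tr (w ⊗ x₁) ⁻¹ ⊗ x₁
    v-x₀ : Tr (v ⊗ x₀) ≡ 0#
    v-x₀ = trans (Tr-scale v _ x₁ b∈) (trans (cong (Tr (w ⊗ x₁) ⁻¹ ⊗_) Trv≡0) (zeroʳ _))
    w-x₀ : Tr (w ⊗ x₀) ≡ 1#
    w-x₀ = trans (Tr-scale w _ x₁ b∈) (⁻¹-inverseˡ Trw≢0)
    Z-inv : ∀ {c} x → InFq c → Z v (x ⊕ c ⊗ x₀) ≡ Z v x
    Z-inv {c} x c∈ = cong (λ a → ⟦ a ≟ᶠ 0# ⟧) (trans (Tr-linear v x c x₀ c∈)
      (trans (cong (λ z → Tr (v ⊗ x) ⊕ c ⊗ z) v-x₀) (trans (cong (Tr (v ⊗ x) ⊕_) (zeroʳ c)) (+-identityʳ _))))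
    shift : ∀ {c} x → InFq c → Tr (w ⊗ (x ⊕ c ⊗ x₀)) ≡ Tr (w ⊗ x) ⊕ c
    shift {c} x c∈ = trans (Tr-linear w x c x₀ c∈)
      (cong (Tr (w ⊗ x) ⊕_) (trans (cong (c ⊗_) w-x₀) (*-identityʳ c)))

-- Arithmetic of the parameters

Sign : ℤ → Set
Sign ε = ε ≡ + 1 ⊎ ε ≡ - + 1

module Parameters (ε r s : ℤ) where
  K Λ Μ : ℤ
  K = r * (s - ε)
  Λ = ε * s + r * r - + 3 * ε * r
  Μ = r * r - ε * r

  -- The restricted eigenvalues of the strongly regular graph, that is, the roots of θ² = (K - Μ) +
  -- (Λ - Μ) θ.
  Eigenvalue : ℤ → Set
  Eigenvalue θ = θ ≡ - (ε * r) ⊎ θ ≡ ε * (s - r)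

  -- The usual relation k(k - λ - 1) = (v - k - 1)μ, rearranged. The sign is fixed first because ε²
  -- = 1 is not an identity known to the ring solver.
  valency-equation : Sign ε → K * K ≡ (K - Μ) + (Λ - Μ) * K + Μ * (s * s)
  valency-equation (inj₁ refl) = solve 2 (λ r s →
    let ε = con (+ 1); K = r :* (s :- ε); Μ = r :* r :- ε :* r
        Λ = ε :* s :+ r :* r :- con (+ 3) :* ε :* r in
    K :* K := (K :- Μ) :+ (Λ :- Μ) :* K :+ Μ :* (s :* s)) refl r s
  valency-equation (inj₂ refl) = solve 2 (λ r s →
    let ε = con (- + 1); K = r :* (s :- ε); Μ = r :* r :- ε :* r
        Λ = ε :* s :+ r :* r :- con (+ 3) :* ε :* r in
    K :* K := (K :- Μ) :+ (Λ :- Μ) :* K :+ Μ :* (s :* s)) refl r s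

  eigenvalue-factorisation : Sign ε → ∀ θ →
    (θ + ε * r) * (θ - ε * (s - r)) ≡ θ * θ - ((K - Μ) + (Λ - Μ) * θ)
  eigenvalue-factorisation (inj₁ refl) θ = solve 3 (λ r s θ →
    let ε = con (+ 1); K = r :* (s :- ε); Μ = r :* r :- ε :* r
        Λ = ε :* s :+ r :* r :- con (+ 3) :* ε :* r in
    (θ :+ ε :* r) :* (θ :- ε :* (s :- r)) := θ :* θ :- ((K :- Μ) :+ (Λ :- Μ) :* θ)) refl r s θ
  eigenvalue-factorisation (inj₂ refl) θ = solve 3 (λ r s θ →
    let ε = con (- + 1); K = r :* (s :- ε); Μ = r :* r :- ε :* r
        Λ = ε :* s :+ r :* r :- con (+ 3) :* ε :* r in
    (θ :+ ε :* r) :* (θ :- ε :* (s :- r)) := θ :* θ :- ((K :- Μ) :+ (Λ :- Μ) :* θ)) refl r s θ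

  -- q times the count of pairs minus the valency equation leaves (q - 1) times the
  -- quadratic equation for θ = N₀ - N₁.
  θ-quadratic : ∀ q′ {N₀ N₁ h} → Sign ε → K ≡ N₀ + q′ * N₁ →
    N₀ * N₀ + (K - N₀) * N₁ ≡ (K - Μ) + (Λ - Μ) * N₀ + Μ * h →
    (1ℤ + q′) * h ≡ s * s →
    let θ = N₀ - N₁ in q′ * (θ * θ - ((K - Μ) + (Λ - Μ) * θ)) ≡ 0ℤ
  θ-quadratic q′ {N₀} {N₁} {h} sgn K≡ pairs qh≡ = begin
    q′ * (θ * θ - ((K - Μ) + (Λ - Μ) * θ))
      ≡⟨ expand K K≡ ⟩
    (1ℤ + q′) * ((N₀ * N₀ + (K - N₀) * N₁) - ((K - Μ) + (Λ - Μ) * N₀ + Μ * h))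
      + Μ * ((1ℤ + q′) * h - s * s) - (K * K - ((K - Μ) + (Λ - Μ) * K + Μ * (s * s)))
      ≡⟨ cong₂ _-_ (cong₂ _+_ (cong ((1ℤ + q′) *_) (ℤ.i≡j⇒i-j≡0 pairs)) (cong (Μ *_) (ℤ.i≡j⇒i-j≡0 qh≡)))
                   (ℤ.i≡j⇒i-j≡0 (valency-equation sgn)) ⟩
    (1ℤ + q′) * 0ℤ + Μ * 0ℤ - 0ℤ
      ≡⟨ solve 2 (λ a b → a :* con 0ℤ :+ b :* con 0ℤ :- con 0ℤ := con 0ℤ) refl (1ℤ + q′) Μ ⟩
    0ℤ ∎
    where
    open ≡-Reasoning
    θ : ℤ
    θ = N₀ - N₁
    expand : ∀ k → k ≡ N₀ + q′ * N₁ → q′ * (θ * θ - ((k - Μ) + (Λ - Μ) * θ)) ≡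
      (1ℤ + q′) * ((N₀ * N₀ + (k - N₀) * N₁) - ((k - Μ) + (Λ - Μ) * N₀ + Μ * h))
      + Μ * ((1ℤ + q′) * h - s * s) - (k * k - ((k - Μ) + (Λ - Μ) * k + Μ * (s * s)))
    expand _ refl = solve 7 (λ q′ N₀ N₁ h S Λ Μ →
      let k = N₀ :+ q′ :* N₁; θ = N₀ :- N₁; q = con 1ℤ :+ q′ in
      q′ :* (θ :* θ :- ((k :- Μ) :+ (Λ :- Μ) :* θ)) :=
      q :* ((N₀ :* N₀ :+ (k :- N₀) :* N₁) :- ((k :- Μ) :+ (Λ :- Μ) :* N₀ :+ Μ :* h))
      :+ Μ :* (q :* h :- S) :- (k :* k :- ((k :- Μ) :+ (Λ :- Μ) :* k :+ Μ :* S)))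
      refl q′ N₀ N₁ h (s * s) Λ Μ

  eigenvalue : ∀ q′ → q′ ≢ 0ℤ → ∀ {N₀ N₁ h} → Sign ε → K ≡ N₀ + q′ * N₁ →
    N₀ * N₀ + (K - N₀) * N₁ ≡ (K - Μ) + (Λ - Μ) * N₀ + Μ * h →
    (1ℤ + q′) * h ≡ s * s → Eigenvalue (N₀ - N₁)
  eigenvalue q′ q′≢0 {N₀} {N₁} sgn K≡ pairs qh≡ with ℤ.i*j≡0⇒i≡0∨j≡0 q′ (θ-quadratic q′ sgn K≡ pairs qh≡)
  ... | inj₁ q′≡0 = contradiction q′≡0 q′≢0
  ... | inj₂ quadratic≡0
      with ℤ.i*j≡0⇒i≡0∨j≡0 (N₀ - N₁ + ε * r) (trans (eigenvalue-factorisation sgn (N₀ - N₁)) quadratic≡0)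
  ...   | inj₁ eq = inj₁ (trans (solve 2 (λ a b → a := a :+ b :- b) refl (N₀ - N₁) (ε * r))
                           (trans (cong (_- ε * r) eq) (ℤ.+-identityˡ _)))
  ...   | inj₂ eq = inj₂ (ℤ.i-j≡0⇒i≡j _ _ eq)

-- For ε = 1 the bound on r says that D is a proper subset, for ε = -1 that its valency is below s².
Admissible : ℤ → (q r s : ℕ) → Set
Admissible ε q r s =
  (ε ≡ + 1 × r ≢ s × 1 < r × r ≤ s) ⊎
  (ε ≡ - + 1 × r ≢ s ∸ 1 × (q ∸ 1) ℕ.* s < r ℕ.* (s ℕ.+ q) × r < s)

private
  pos : ∀ a b → + a * + b ≡ + (a ℕ.* b)
  pos a b = sym (ℤ.pos-* a b)

-- The size hypothesis says |D| ≤ s² - 2. For ε = 1, r ≥ s + 1 would make |D| at least (s + 1)(s -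
-- 1) = s² - 1; for ε = -1, r ≥ s would make it at least s(s + 1).
r-bound : ∀ {ε} q r s → 2 ≤ s → 0ℤ ℤ.≤ + s * + s - + r * (+ s - ε) - + 2 →
  (ε ≡ + 1 × r ≢ s × 1 < r) ⊎ (ε ≡ - + 1 × r ≢ s ∸ 1 × (q ∸ 1) ℕ.* s < r ℕ.* (s ℕ.+ q)) →
  Admissible ε q r s
r-bound q r s@(suc s-1) 2≤s size (inj₁ (refl , r≢s , 1<r)) = inj₁ (refl , r≢s , 1<r , ℕ.≮⇒≥ r≯s)
  where
  r≯s : ¬ s < r
  r≯s s<r with ℕ.m≤n⇒∃[o]m+o≡n s<r
  ... | t , refl = contradiction (subst (0ℤ ℤ.≤_) (trans
          (solve 2 (λ s t → let S = con (+ 1) :+ s in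
             S :* S :- (con (+ 1) :+ S :+ t) :* (S :- con (+ 1)) :- con (+ 2) := :- (con (+ 1) :+ t :* s)) refl (+ s-1) (+ t))
          (cong (λ z → - (+ 1 + z)) (pos t s-1))) size) (λ ())
r-bound q r s@(suc s-1) 2≤s size (inj₂ (refl , r≢s-1 , big)) = inj₂ (refl , r≢s-1 , big , ℕ.≰⇒> s≰r)
  where
  s≰r : ¬ s ≤ r
  s≰r s≤r with ℕ.m≤n⇒∃[o]m+o≡n s≤r
  ... | t , refl = contradiction (subst (0ℤ ℤ.≤_) (trans
          (solve 2 (λ s t → let S = con (+ 1) :+ s in
             S :* S :- (S :+ t) :* (S :- con (- + 1)) :- con (+ 2) := :- (con (+ 3) :+ s :+ t :+ t :* S)) refl (+ s-1) (+ t))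
          (cong (λ z → - (+ 3 + + s-1 + + t + z)) (pos t s))) size) (λ ())

-- Coincidences of eigenvalues that cannot occur

module Exclusions {ε : ℤ} {q-1 r s : ℕ} (1≤r : 1 ≤ r) (q<s : suc q-1 < s) where
  open Parameters ε (+ r) (+ s)

  private
    q : ℕ
    q = suc q-1
    instance
      s-nonZero : NonZero s
      s-nonZero = ℕ.>-nonZero (ℕ.≤-<-trans z≤n q<s)
      r-nonZero : NonZero r
      r-nonZero = ℕ.>-nonZero 1≤r

    cancel-s : ∀ {a} b → a * + s ≡ + b * + s → a ≡ + b
    cancel-s {a} b = ℤ.*-cancelʳ-≡ a (+ b) (+ s) {{s-nonZero}}

    rs≢0 : + r * + s ≢ 0ℤ
    rs≢0 eq = ℕ.≢-nonZero⁻¹ (r ℕ.* s) {{ℕ.m*n≢0 r s}} (ℤ.+-injective (trans (sym (pos r s)) eq))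

  -- K - θ = q N₁, so equality would put the whole fibre Tr(wx) = 1 into D. The left side is rs or
  -- (r - 1)s for ε = 1 and rs or (r + 1)s for ε = -1; `Admissible` excludes the r that make it s².
  complement⊄hyperplane : ∀ {θ} → Admissible ε q r s → Eigenvalue θ → K - θ ≢ + s * + s
  complement⊄hyperplane (inj₁ (refl , r≢s , _)) (inj₁ refl) eq = r≢s (ℤ.+-injective (cancel-s s (trans
          (solve 2 (λ r s → r :* s := r :* (s :- con (+ 1)) :- (:- (con (+ 1) :* r))) refl (+ r) (+ s)) eq)))
  complement⊄hyperplane (inj₂ (refl , _ , _ , r<s)) (inj₁ refl) eq = ℕ.<⇒≢ r<s (ℤ.+-injective (cancel-s s (trans
          (solve 2 (λ r s → r :* s := r :* (s :- con (- + 1)) :- (:- (con (- + 1) :* r))) refl (+ r) (+ s)) eq)))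
  complement⊄hyperplane (inj₁ (refl , _ , _ , r≤s)) (inj₂ refl) eq = ℕ.<⇒≱ (ℕ.≤-reflexive (sym r≡1+s)) r≤s
    where
    r≡1+s : r ≡ suc s
    r≡1+s = ℤ.+-injective (cancel-s (suc s) (trans
      (solve 2 (λ r s → r :* s := r :* (s :- con (+ 1)) :- (con (+ 1) :* (s :- r)) :+ s) refl (+ r) (+ s))
      (trans (cong (_+ + s) eq) (solve 1 (λ s → s :* s :+ s := (con (+ 1) :+ s) :* s) refl (+ s)))))
  complement⊄hyperplane (inj₂ (refl , r≢s-1 , _)) (inj₂ refl) eq = r≢s-1 (cong (_∸ 1) 1+r≡s)
    where
    1+r≡s : suc r ≡ s
    1+r≡s = ℤ.+-injective (cancel-s {+ suc r} s (trans
      (solve 2 (λ r s → (con (+ 1) :+ r) :* s := r :* (s :- con (- + 1)) :- (con (- + 1) :* (s :- r))) refl (+ r) (+ s)) eq))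

  -- Two eigenvalues differ by 0, s or -s, whereas h = s²/q is larger than s because q < s.
  eigenvalue-gap : ∀ {θ₁ θ₂ h} → Sign ε → Eigenvalue θ₁ → Eigenvalue θ₂ → + q * h ≡ + s * + s → θ₁ - θ₂ ≢ h
  eigenvalue-gap {θ₁} {θ₂} sgn e₁ e₂ qh≡ refl = [ gap≢0 , [ gap≢s , gap≢-s ]′ ]′ (gaps sgn e₁ e₂)
    where
    S : ℤ
    S = + s
    gaps : Sign ε → Eigenvalue θ₁ → Eigenvalue θ₂ →
      θ₁ - θ₂ ≡ 0ℤ ⊎ θ₁ - θ₂ ≡ S ⊎ θ₁ - θ₂ ≡ - S
    gaps _ (inj₁ refl) (inj₁ refl) = inj₁ (ℤ.i≡j⇒i-j≡0 { - (ε * + r)} refl)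
    gaps _ (inj₂ refl) (inj₂ refl) = inj₁ (ℤ.i≡j⇒i-j≡0 {ε * (S - + r)} refl)
    gaps (inj₁ refl) (inj₁ refl) (inj₂ refl) = inj₂ (inj₂ (solve 2 (λ r s → let ε = con (+ 1) in
      (:- (ε :* r)) :- ε :* (s :- r) := :- s) refl (+ r) S))
    gaps (inj₂ refl) (inj₁ refl) (inj₂ refl) = inj₂ (inj₁ (solve 2 (λ r s → let ε = con (- + 1) in
      (:- (ε :* r)) :- ε :* (s :- r) := s) refl (+ r) S))
    gaps (inj₁ refl) (inj₂ refl) (inj₁ refl) = inj₂ (inj₁ (solve 2 (λ r s → let ε = con (+ 1) in
      ε :* (s :- r) :- (:- (ε :* r)) := s) refl (+ r) S))
    gaps (inj₂ refl) (inj₂ refl) (inj₁ refl) = inj₂ (inj₂ (solve 2 (λ r s → let ε = con (- + 1) in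
      ε :* (s :- r) :- (:- (ε :* r)) := :- s) refl (+ r) S))
    gap≢0 : θ₁ - θ₂ ≢ 0ℤ
    gap≢0 eq = ℕ.≢-nonZero⁻¹ (s ℕ.* s) {{ℕ.m*n≢0 s s}} (ℤ.+-injective (trans (sym (pos s s))
      (trans (sym qh≡) (trans (cong (+ q *_) eq) (ℤ.*-zeroʳ (+ q))))))
    gap≢s : θ₁ - θ₂ ≢ S
    gap≢s eq = ℕ.<⇒≢ q<s (ℤ.+-injective (cancel-s s (trans (cong (+ q *_) (sym eq)) qh≡)))
    gap≢-s : θ₁ - θ₂ ≢ - S
    gap≢-s eq = -[1+]≢+ (cancel-s s (trans
      (solve 2 (λ q s → (:- q) :* s := q :* (:- s)) refl (+ q) S) (trans (cong (+ q *_) (sym eq)) qh≡)))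
      where
      -[1+]≢+ : - + q ≢ + s
      -[1+]≢+ ()

  -- Equality would mean N₁ = 0. Of the values rs, (r - 1)s and (r + 1)s of K - θ only the second
  -- can vanish; it occurs for ε = 1, where r > 1.
  D⊄hyperplane : ∀ {θ} → Admissible ε q r s → Eigenvalue θ → K ≢ θ
  D⊄hyperplane (inj₁ (refl , _)) (inj₁ refl) eq = rs≢0 (trans
          (solve 2 (λ r s → r :* s := r :* (s :- con (+ 1)) :- (:- (con (+ 1) :* r))) refl (+ r) (+ s)) (ℤ.i≡j⇒i-j≡0 eq))
  D⊄hyperplane (inj₂ (refl , _)) (inj₁ refl) eq = rs≢0 (trans
          (solve 2 (λ r s → r :* s := r :* (s :- con (- + 1)) :- (:- (con (- + 1) :* r))) refl (+ r) (+ s)) (ℤ.i≡j⇒i-j≡0 eq))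
  D⊄hyperplane (inj₁ (refl , _ , 1<r , _)) (inj₂ refl) eq = ℕ.<⇒≢ 1<r (sym (ℤ.+-injective (cancel-s 1 (trans
          (solve 2 (λ r s → r :* s := r :* (s :- con (+ 1)) :- (con (+ 1) :* (s :- r)) :+ con (+ 1) :* s) refl (+ r) (+ s))
          (trans (cong (_+ (+ 1 * + s)) (ℤ.i≡j⇒i-j≡0 eq)) (ℤ.+-identityˡ _))))))
  D⊄hyperplane (inj₂ (refl , _)) (inj₂ refl) eq = contradiction (cancel-s {+ suc r} 0 (trans
          (solve 2 (λ r s → (con (+ 1) :+ r) :* s := r :* (s :- con (- + 1)) :- (con (- + 1) :* (s :- r))) refl (+ r) (+ s))
          (trans (ℤ.i≡j⇒i-j≡0 eq) (sym (ℤ.*-zeroˡ (+ s)))))) (λ ())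

  -- The left side is q N₀. For ε = 1 it is r(s - q) or r(s - q) + (q - 1)s, nonzero since s > q;
  -- for ε = -1 it is r(s + q) or r(s + q) - (q - 1)s, and the lower bound on r handles the latter.
  D-meets-hyperplane : ∀ {θ} → Admissible ε q r s → Eigenvalue θ → K + + q-1 * θ ≢ 0ℤ
  D-meets-hyperplane (inj₁ (refl , _)) (inj₁ refl) eq = ℕ.<⇒≢ q<s (sym (ℤ.+-injective
        (ℤ.*-cancelˡ-≡ (+ r) (+ s) (+ q) {{r-nonZero}} (ℤ.i-j≡0⇒i≡j _ _ (trans
          (solve 3 (λ r s q′ → r :* s :- r :* (con (+ 1) :+ q′) := r :* (s :- con (+ 1)) :+ q′ :* (:- (con (+ 1) :* r)))
                refl (+ r) (+ s) (+ q-1)) eq)))))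
  D-meets-hyperplane (inj₂ (refl , _)) (inj₁ refl) eq = contradiction (ℤ.+-injective {r ℕ.* (s ℕ.+ q)} {0} (trans
        (sym (pos r (s ℕ.+ q))) (trans
          (solve 3 (λ r s q′ → r :* (s :+ (con (+ 1) :+ q′)) := r :* (s :- con (- + 1)) :+ q′ :* (:- (con (- + 1) :* r))) refl (+ r) (+ s) (+ q-1)) eq)))
          (ℕ.≢-nonZero⁻¹ _ {{ℕ.m*n≢0 r (s ℕ.+ q) {{r-nonZero}} {{ℕ.>-nonZero (ℕ.<-≤-trans (ℕ.>-nonZero⁻¹ s) (ℕ.m≤m+n s q))}}}})
  D-meets-hyperplane (inj₂ (refl , _ , big , _)) (inj₂ refl) eq = ℕ.<⇒≢ big (sym (ℤ.+-injective (trans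
        (sym (pos r (s ℕ.+ q))) (trans (ℤ.i-j≡0⇒i≡j _ _ (trans
          (solve 3 (λ r s q′ → r :* (s :+ (con (+ 1) :+ q′)) :- q′ :* s := r :* (s :- con (- + 1)) :+ q′ :* (con (- + 1) :* (s :- r))) refl (+ r) (+ s) (+ q-1)) eq))
          (pos q-1 s)))))
  -- Writing s = q + 1 + b turns r(s - q) + (q - 1)s into a sum of natural numbers whose first term
  -- r(b + 1) is positive.
  D-meets-hyperplane (inj₁ (refl , _ , _ , r≤s)) (inj₂ refl) eq with ℕ.m≤n⇒∃[o]m+o≡n r≤s | ℕ.m≤n⇒∃[o]m+o≡n q<s
  ...   | a , r+a≡s | b , q+b≡s = contradiction (ℤ.+-injective {r ℕ.* suc b ℕ.+ q-1 ℕ.* s} {0} (begin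
          + (r ℕ.* suc b) + + (q-1 ℕ.* s)
            ≡⟨ cong₂ _+_ (pos r (suc b)) (pos q-1 s) ⟨
          + r * + suc b + + q-1 * + s
            ≡⟨ solve 4 (λ r s q′ B → r :* B :+ q′ :* s := r :* ((con (+ 1) :+ q′ :+ B) :- con (+ 1)) :+ q′ :* (con (+ 1) :* (s :- r))) refl (+ r) (+ s) (+ q-1) (+ suc b) ⟩
          + r * (+ (q ℕ.+ suc b) - + 1) + + q-1 * (+ 1 * (+ s - + r))
            ≡⟨ cong (λ z → + r * (+ z - + 1) + + q-1 * (+ 1 * (+ s - + r))) (trans (ℕ.+-suc q b) q+b≡s) ⟩
          + r * (+ s - + 1) + + q-1 * (+ 1 * (+ s - + r))
            ≡⟨ eq ⟩
          0ℤ ∎))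
          (ℕ.≢-nonZero⁻¹ _ {{ℕ.>-nonZero (ℕ.<-≤-trans (ℕ.>-nonZero⁻¹ (r ℕ.* suc b) {{ℕ.m*n≢0 r (suc b)}})
                (ℕ.m≤m+n _ (q-1 ℕ.* s)))}})
    where open ≡-Reasoning

  private
    s²≰4r : 5 ≤ s → r ≤ s → ∀ x → s ℕ.* s ℕ.+ x ≢ 4 ℕ.* r
    s²≰4r 5≤s r≤s x eq = ℕ.<⇒≱ (begin-strict
      4 ℕ.* r           ≤⟨ ℕ.*-monoʳ-≤ 4 r≤s ⟩
      4 ℕ.* s           <⟨ ℕ.*-monoˡ-< s 5≤s ⟩
      s ℕ.* s           ∎) (ℕ.≤-trans (ℕ.m≤m+n (s ℕ.* s) x) (ℕ.≤-reflexive eq))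
      where open ℕ.≤-Reasoning

    s²≰cs : ∀ {c} → c < s → ∀ x → s ℕ.* s ℕ.+ x ≢ c ℕ.* s
    s²≰cs {c} c<s x eq = ℕ.<⇒≱ (ℕ.*-monoˡ-< s c<s) (ℕ.≤-trans (ℕ.m≤m+n (s ℕ.* s) x) (ℕ.≤-reflexive eq))

    ε=1-sum : 5 ≤ s → r ≤ s → ∀ c → + s * + s + + c * + s ≢ + 4 * + r
    ε=1-sum 5≤s r≤s c eq = s²≰4r 5≤s r≤s (c ℕ.* s) (ℤ.+-injective
      (trans (sym (cong₂ _+_ (pos s s) (pos c s))) (trans eq (pos 4 r))))

    ε=-1-sum : ∀ {c} → c < s → + s * + s + + 4 * + r ≢ + c * + s
    ε=-1-sum {c} c<s eq = s²≰cs c<s (4 ℕ.* r) (ℤ.+-injective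
      (trans (sym (cong₂ _+_ (pos s s) (pos 4 r))) (trans eq (pos c s))))

  -- Equality would give s² = -2(θ₁ + θ₂). The right side is 4r, 4r - 2s or 4r - 4s for ε = 1 and
  -- -4r, 2s - 4r or 4s - 4r for ε = -1, so it is at most 4s, which is below s² once s ≥ 5.
  eigenvalue-sum : ∀ {θ₁ θ₂ h} → Admissible ε q r s → 5 ≤ s → Eigenvalue θ₁ →
        Eigenvalue θ₂ → + 2 * h ≡ + s * + s → θ₁ + θ₂ ≢ - h
  eigenvalue-sum {θ₁} {θ₂} {h} admissible 5≤s e₁ e₂ 2h≡ eq = sums admissible e₁ e₂
    where
    4<s : 4 < s
    4<s = 5≤s
    square : + s * + s ≡ - (+ 2 * (θ₁ + θ₂))
    square = trans (sym 2h≡) (trans (solve 1 (λ h → con (+ 2) :* h := :- (con (+ 2) :* (:- h))) refl h)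
      (cong (λ z → - (+ 2 * z)) (sym eq)))
    sums : Admissible ε q r s → Eigenvalue θ₁ → Eigenvalue θ₂ → ⊥
    sums (inj₁ (refl , _ , _ , r≤s)) (inj₁ refl) (inj₁ refl) = ε=1-sum 5≤s r≤s 0 (trans (cong (_+ + 0 * + s) square)
      (solve 2 (λ r s → let a = :- (con (+ 1) :* r) in (:- (con (+ 2) :* (a :+ a))) :+ con (+ 0) :* s := con (+ 4) :* r)
            refl (+ r) (+ s)))
    sums (inj₁ (refl , _ , _ , r≤s)) (inj₁ refl) (inj₂ refl) = ε=1-sum 5≤s r≤s 2 (trans (cong (_+ + 2 * + s) square)
      (solve 2 (λ r s → let a = :- (con (+ 1) :* r); b = con (+ 1) :* (s :- r) in (:- (con (+ 2) :* (a :+ b))) :+ con (+ 2) :* s := con (+ 4) :* r) refl (+ r) (+ s)))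
    sums (inj₁ (refl , _ , _ , r≤s)) (inj₂ refl) (inj₁ refl) = ε=1-sum 5≤s r≤s 2 (trans (cong (_+ + 2 * + s) square)
      (solve 2 (λ r s → let a = :- (con (+ 1) :* r); b = con (+ 1) :* (s :- r) in (:- (con (+ 2) :* (b :+ a))) :+ con (+ 2) :* s := con (+ 4) :* r) refl (+ r) (+ s)))
    sums (inj₁ (refl , _ , _ , r≤s)) (inj₂ refl) (inj₂ refl) = ε=1-sum 5≤s r≤s 4 (trans (cong (_+ + 4 * + s) square)
      (solve 2 (λ r s → let b = con (+ 1) :* (s :- r) in (:- (con (+ 2) :* (b :+ b))) :+ con (+ 4) :* s := con (+ 4) :* r) refl (+ r) (+ s)))
    sums (inj₂ (refl , _)) (inj₁ refl) (inj₁ refl) = ε=-1-sum {0} (ℕ.≤-trans (s≤s z≤n) 4<s) (trans (cong (_+ + 4 * + r) square)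
      (solve 2 (λ r s → let a = :- (con (- + 1) :* r) in (:- (con (+ 2) :* (a :+ a))) :+ con (+ 4) :* r := con (+ 0) :* s) refl (+ r) (+ s)))
    sums (inj₂ (refl , _)) (inj₁ refl) (inj₂ refl) = ε=-1-sum {2} (ℕ.≤-trans (s≤s (s≤s (s≤s z≤n))) 4<s) (trans
          (cong (_+ + 4 * + r) square)
      (solve 2 (λ r s → let a = :- (con (- + 1) :* r); b = con (- + 1) :* (s :- r) in (:- (con (+ 2) :* (a :+ b))) :+ con (+ 4) :* r := con (+ 2) :* s) refl (+ r) (+ s)))
    sums (inj₂ (refl , _)) (inj₂ refl) (inj₁ refl) = ε=-1-sum {2} (ℕ.≤-trans (s≤s (s≤s (s≤s z≤n))) 4<s) (trans
          (cong (_+ + 4 * + r) square)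
      (solve 2 (λ r s → let a = :- (con (- + 1) :* r); b = con (- + 1) :* (s :- r) in (:- (con (+ 2) :* (b :+ a))) :+ con (+ 4) :* r := con (+ 2) :* s) refl (+ r) (+ s)))
    sums (inj₂ (refl , _)) (inj₂ refl) (inj₂ refl) = ε=-1-sum {4} 4<s (trans (cong (_+ + 4 * + r) square)
      (solve 2 (λ r s → let b = con (- + 1) :* (s :- r) in (:- (con (+ 2) :* (b :+ b))) :+ con (+ 4) :* r := con (+ 4) :* s) refl (+ r) (+ s)))

-- Eigenvalues of the difference set and minimality

module DifferenceSet (L : FiniteField) (q-1 m-1 : ℕ) (2≤q : 2 ≤ suc q-1)
    (size≡ : FiniteField.size L ≡ suc q-1 ^ suc m-1)
    (frob : ∀ x y → FiniteField._^_ L (FiniteField._+_ L x y) (suc q-1)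
                    ≡ FiniteField._+_ L (FiniteField._^_ L x (suc q-1)) (FiniteField._^_ L y (suc q-1)))
    (D : Pred (FiniteField.Carrier L) 0ℓ) (D? : ∀ x → Dec (D x))
    (D-invariant : Setting.FqInvariant L (suc q-1) (suc m-1) D D?)
    (D-nonzero : ∀ x → D x → x ≢ FiniteField.0# L) where
  open FiniteField L renaming
    (_+_ to infixl 6 _⊕_; _*_ to infixl 7 _⊗_; -_ to infix 8 ⊖_; _^_ to infixr 8 _^ᶠ_; _≟_ to infix 4 _≟ᶠ_)
  open FieldProperties L
  open Counting L
  open Trace L (suc q-1) m-1 2≤q size≡ frob
  open Setting L (suc q-1) (suc m-1) using (InFq; Tr; IsSRG; commonNbrs; degree; Adj?; fD; cw; IsMinimalCode)

  private
    module FS = SemiringSolver commutativeSemiring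
    q : ℕ
    q = suc q-1

  d : Carrier → ℤ
  d x = ⟦ D? x ⟧

  d-scale : ∀ {a} x → InFq a → a ≢ 0# → d (a ⊗ x) ≡ d x
  d-scale {a} x a∈ a≢0 = ⟦⟧-cong (D? _) (D? x) (proj₂ (D-invariant a a∈ a≢0 x)) (proj₁ (D-invariant a a∈ a≢0 x))

  d-0 : d 0# ≡ 0ℤ
  d-0 = ⟦⟧-no (D? 0#) (λ D0 → D-nonzero 0# D0 refl)

  N : Carrier → Carrier → ℤ
  N v a = ∑ (λ x → d x * ⟦ a ≟ᶠ Tr (v ⊗ x) ⟧)

  -- By `N-scale` every nonzero value is taken N₁ times, and a nontrivial additive character of F_q
  -- sums to -1 over the nonzero elements. So θ(v) is the character sum of D at v.
  N₀ N₁ θ : Carrier → ℤ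
  N₀ v = N v 0#
  N₁ v = N v 1#
  θ v = N₀ v - N₁ v

  -- Multiplication by a preserves D and carries the fibre over 1 to the fibre over a.
  N-scale : ∀ v {a} → InFq a → a ≢ 0# → N v a ≡ N₁ v
  N-scale v {a} a∈ a≢0 = trans
    (sym (∑-reindex (a ⊗_) (a ⁻¹ ⊗_) (λ x → ⊗⁻¹-cancel x a≢0) (λ x → ⁻¹⊗-cancel x a≢0) _))
    (∑-cong (λ x → cong₂ _*_ (d-scale x a∈ a≢0)
      (⟦⟧-cong (a ≟ᶠ _) (1# ≟ᶠ _)
        (λ eq → trans (sym (⁻¹-inverseˡ a≢0)) (trans (cong (a ⁻¹ ⊗_) (trans eq (Tr-scale v a x a∈))) (⁻¹⊗-cancel _ a≢0)))
        (λ eq → sym (trans (Tr-scale v a x a∈) (trans (cong (a ⊗_) (sym eq)) (*-identityʳ a)))))))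

  Z-sym : ∀ v x → ⟦ 0# ≟ᶠ Tr (v ⊗ x) ⟧ ≡ Z v x
  Z-sym v x = ⟦⟧-cong (0# ≟ᶠ _) (_ ≟ᶠ 0#) sym sym

  N₀≡ : ∀ v → N₀ v ≡ ∑ (λ x → d x * Z v x)
  N₀≡ v = ∑-cong (λ x → cong (d x *_) (Z-sym v x))

  -- Being affine in the indicator of a = 0, this form can be summed over a, or over a = Tr(vy) with
  -- y in D, without case distinctions.
  N-by-value : ∀ v {a} → InFq a → N v a ≡ ⟦ a ≟ᶠ 0# ⟧ * θ v + N₁ v
  N-by-value v {a} a∈ with a ≟ᶠ 0#
  ... | yes refl = solve 2 (λ a b → a := con 1ℤ :* (a :- b) :+ b) refl (N₀ v) (N₁ v)
  ... | no a≢0 = trans (N-scale v a∈ a≢0) (solve 2 (λ a b → b := con 0ℤ :* (a :- b) :+ b) refl (N₀ v) (N₁ v))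

  |D|-by-fibres : ∀ v → ∑ d ≡ N₀ v + + q-1 * N₁ v
  |D|-by-fibres v = begin
    ∑ d
      ≡⟨ fibrewise d (λ x → Tr (v ⊗ x)) (λ x → Tr-InFq _) ⟩
    ∑ (λ a → φ a * N v a)
      ≡⟨ ∑-cong (λ a → trans (⟦⟧-guard (InFq? a) (N-by-value v)) (solve 4
            (λ f i t n → f :* (i :* t :+ n) := i :* (f :* t) :+ f :* n) refl (φ a) ⟦ a ≟ᶠ 0# ⟧ (θ v) (N₁ v))) ⟩
    ∑ (λ a → ⟦ a ≟ᶠ 0# ⟧ * (φ a * θ v) + φ a * N₁ v)
      ≡⟨ ∑-∙ _ _ ⟩
    ∑ (λ a → ⟦ a ≟ᶠ 0# ⟧ * (φ a * θ v)) + ∑ (λ a → φ a * N₁ v)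
      ≡⟨ cong₂ _+_ (trans (∑-δ (λ a → φ a * θ v) 0#) (cong (_* θ v) (⟦⟧-yes (InFq? 0#) InFq-0)))
                   (trans (∑-*ʳ φ (N₁ v)) (cong (_* N₁ v) ∑φ≡q)) ⟩
    1ℤ * θ v + + q * N₁ v
      ≡⟨ solve 3 (λ a b q′ → con 1ℤ :* (a :- b) :+ (con 1ℤ :+ q′) :* b := a :+ q′ :* b) refl (N₀ v) (N₁ v) (+ q-1) ⟩
    N₀ v + + q-1 * N₁ v ∎
    where open ≡-Reasoning

  qN₀ : ∀ v → + q * N₀ v ≡ ∑ d + + q-1 * θ v
  qN₀ v = trans (solve 3 (λ a b q′ → (con 1ℤ :+ q′) :* a := (a :+ q′ :* b) :+ q′ :* (a :- b)) refl (N₀ v) (N₁ v) (+ q-1))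
    (cong (_+ + q-1 * θ v) (sym (|D|-by-fibres v)))

  degree-0 : + degree D D? 0# ≡ ∑ d
  degree-0 = trans (∑-⟦⟧ (Adj? D D? 0#)) (trans
    (∑-cong (λ z → cong d (+-identityˡ (⊖ z))))
    (∑-reindex ⊖_ ⊖_ -‿involutive -‿involutive d))

  commonNbrs-0 : ∀ g → + commonNbrs D D? g 0# ≡ ∑ (λ z → d (g ⊕ ⊖ z) * d (0# ⊕ ⊖ z))
  commonNbrs-0 g = trans (∑-⟦⟧ (λ z → Adj? D D? g z ×-dec Adj? D D? 0# z))
    (∑-cong (λ z → ⟦⟧-× (Adj? D D? g z) (Adj? D D? 0# z)))

  -- After the substitution z = -y, the common neighbours of g and 0 correspond to the pairs (x , y)
  -- in D² with x - y = g. For fixed y the admissible x form the fibre of D over Tr(vy): N₀ of them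
  -- if y lies in H_v, N₁ otherwise.
  pairs : ∀ v → ∑ (λ g → Z v g * + commonNbrs D D? g 0#) ≡ N₀ v * N₀ v + (∑ d - N₀ v) * N₁ v
  pairs v = begin
    ∑ (λ g → Z v g * + commonNbrs D D? g 0#)
      ≡⟨ ∑-cong (λ g → trans (cong (Z v g *_) (commonNbrs-0 g)) (sym (∑-*ˡ (Z v g) _))) ⟩
    ∑ (λ g → ∑ (λ z → Z v g * (d (g ⊕ ⊖ z) * d (0# ⊕ ⊖ z))))
      ≡⟨ ∑-swap _ ⟩
    ∑ (λ z → ∑ (λ g → Z v g * (d (g ⊕ ⊖ z) * d (0# ⊕ ⊖ z))))
      ≡⟨ ∑-cong (λ z → trans (∑-cong (λ g → sym (ℤ.*-assoc (Z v g) _ _))) (∑-*ʳ _ (d (0# ⊕ ⊖ z)))) ⟩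
    ∑ (λ z → ∑ (λ g → Z v g * d (g ⊕ ⊖ z)) * d (0# ⊕ ⊖ z))
      ≡⟨ ∑-reindex ⊖_ ⊖_ -‿involutive -‿involutive _ ⟨
    ∑ (λ y → ∑ (λ g → Z v g * d (g ⊕ ⊖ ⊖ y)) * d (0# ⊕ ⊖ ⊖ y))
      ≡⟨ ∑-cong (λ y → cong₂ _*_ (translated y) (cong d (trans (+-identityˡ _) (-‿involutive y)))) ⟩
    ∑ (λ y → N v (Tr (v ⊗ y)) * d y)
      ≡⟨ ∑-cong (λ y → trans (cong (_* d y) (N-by-value v (Tr-InFq _)))
           (solve 4 (λ z t n d → (z :* t :+ n) :* d := (d :* z) :* t :+ d :* n) refl (Z v y) (θ v) (N₁ v) (d y))) ⟩
    ∑ (λ y → (d y * Z v y) * θ v + d y * N₁ v)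
      ≡⟨ ∑-∙ _ _ ⟩
    ∑ (λ y → (d y * Z v y) * θ v) + ∑ (λ y → d y * N₁ v)
      ≡⟨ cong₂ _+_ (trans (∑-*ʳ _ (θ v)) (cong (_* θ v) (sym (N₀≡ v)))) (∑-*ʳ d (N₁ v)) ⟩
    N₀ v * θ v + ∑ d * N₁ v
      ≡⟨ solve 3 (λ a b k → a :* (a :- b) :+ k :* b := a :* a :+ (k :- a) :* b) refl (N₀ v) (N₁ v) (∑ d) ⟩
    N₀ v * N₀ v + (∑ d - N₀ v) * N₁ v ∎
    where
    open ≡-Reasoning
    translated : ∀ y → ∑ (λ g → Z v g * d (g ⊕ ⊖ ⊖ y)) ≡ N v (Tr (v ⊗ y))
    translated y = begin
      ∑ (λ g → Z v g * d (g ⊕ ⊖ ⊖ y))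
        ≡⟨ ∑-cong (λ g → trans (ℤ.*-comm (Z v g) _) (cong₂ _*_ (cong (λ z → d (g ⊕ z)) (-‿involutive y))
             (cong (Z v) (sym (cancel-⊖ʳ′ g y))))) ⟩
      ∑ (λ g → d (g ⊕ y) * Z v (g ⊕ y ⊕ ⊖ y))
        ≡⟨ ∑-reindex (_⊕ y) (_⊕ ⊖ y) (λ x → cancel-⊖ʳ x y) (λ x → cancel-⊖ʳ′ x y) (λ x → d x * Z v (x ⊕ ⊖ y)) ⟩
      ∑ (λ x → d x * Z v (x ⊕ ⊖ y))
        ≡⟨ ∑-cong (λ x → cong (d x *_) (⟦⟧-cong (_ ≟ᶠ 0#) (_ ≟ᶠ _)
             (λ eq → sym (a⊕⊖b≡0⇒a≡b (trans (sym (Tr-difference x y)) eq)))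
             (λ eq → trans (Tr-difference x y) (trans (cong (λ z → Tr (v ⊗ x) ⊕ ⊖ z) eq) (-‿inverseʳ _))))) ⟩
      N v (Tr (v ⊗ y)) ∎
      where
      Tr-difference : ∀ x y → Tr (v ⊗ (x ⊕ ⊖ y)) ≡ Tr (v ⊗ x) ⊕ ⊖ Tr (v ⊗ y)
      Tr-difference x y = begin
        Tr (v ⊗ (x ⊕ ⊖ y))                 ≡⟨ cong (λ z → Tr (v ⊗ (x ⊕ ⊖ z))) (*-identityˡ y) ⟨
        Tr (v ⊗ (x ⊕ ⊖ (1# ⊗ y)))          ≡⟨ cong (λ z → Tr (v ⊗ (x ⊕ z))) (-‿distribˡ-* 1# y) ⟩
        Tr (v ⊗ (x ⊕ ⊖ 1# ⊗ y))            ≡⟨ Tr-linear v x (⊖ 1#) y (InFq-⊖ InFq-1) ⟩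
        Tr (v ⊗ x) ⊕ ⊖ 1# ⊗ Tr (v ⊗ y)     ≡⟨ cong (Tr (v ⊗ x) ⊕_) (-‿distribˡ-* 1# _) ⟨
        Tr (v ⊗ x) ⊕ ⊖ (1# ⊗ Tr (v ⊗ y))   ≡⟨ cong (λ z → Tr (v ⊗ x) ⊕ ⊖ z) (*-identityˡ _) ⟩
        Tr (v ⊗ x) ⊕ ⊖ Tr (v ⊗ y)          ∎

  -- The second count of the same pairs, by their difference g: there are k for g = 0, λ for g in D
  -- and μ otherwise, that is, μ plus corrections at 0 and on D.
  pairs-srg : ∀ {n k λ′ μ} → IsSRG D D? n k λ′ μ → ∀ v →
    ∑ (λ g → Z v g * + commonNbrs D D? g 0#) ≡ (k - μ) + (λ′ - μ) * N₀ v + μ * ∑ (Z v)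
  pairs-srg {k = k} {λ′} {μ} (_ , _ , _ , _ , _ , regular , adj , nonadj) v = begin
    ∑ (λ g → Z v g * + commonNbrs D D? g 0#)
      ≡⟨ ∑-cong (λ g → trans (cong (Z v g *_) (common g))
           (solve 6 (λ z i d k l m → z :* (i :* (k :- m) :+ d :* (l :- m) :+ m) := i :* (z :* (k :- m)) :+ d :* z :* (l :- m) :+ z :* m) refl
             (Z v g) ⟦ g ≟ᶠ 0# ⟧ (d g) k λ′ μ)) ⟩
    ∑ (λ g → ⟦ g ≟ᶠ 0# ⟧ * (Z v g * (k - μ)) + d g * Z v g * (λ′ - μ) + Z v g * μ)
      ≡⟨ trans (∑-∙ _ _) (cong₂ _+_ (∑-∙ _ _) (∑-*ʳ (Z v) μ)) ⟩
    ∑ (λ g → ⟦ g ≟ᶠ 0# ⟧ * (Z v g * (k - μ))) + ∑ (λ g → d g * Z v g * (λ′ - μ)) + ∑ (Z v) * μ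
      ≡⟨ cong (λ z → z + ∑ (Z v) * μ) (cong₂ _+_
           (trans (∑-δ (λ g → Z v g * (k - μ)) 0#) (cong (_* (k - μ)) (⟦⟧-yes (_ ≟ᶠ 0#) (trans (cong Tr (zeroʳ v)) Tr-0))))
           (trans (∑-*ʳ _ (λ′ - μ)) (cong (_* (λ′ - μ)) (sym (N₀≡ v))))) ⟩
    1ℤ * (k - μ) + N₀ v * (λ′ - μ) + ∑ (Z v) * μ
      ≡⟨ solve 5 (λ k l m n z → con 1ℤ :* (k :- m) :+ n :* (l :- m) :+ z :* m := (k :- m) :+ (l :- m) :* n :+ m :* z)
            refl k λ′ μ (N₀ v) (∑ (Z v)) ⟩
    (k - μ) + (λ′ - μ) * N₀ v + μ * ∑ (Z v) ∎
    where
    open ≡-Reasoning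
    g-0 : ∀ g → g ⊕ ⊖ 0# ≡ g
    g-0 g = trans (sym (cong (_⊕ ⊖ 0#) (+-identityʳ g))) (cancel-⊖ʳ′ g 0#)
    common-0 : + commonNbrs D D? 0# 0# ≡ k
    common-0 = trans (commonNbrs-0 0#) (trans (∑-cong (λ z → idempotent (D? (0# ⊕ ⊖ z))))
      (trans (sym (∑-⟦⟧ (Adj? D D? 0#))) (regular 0#)))
      where
      idempotent : ∀ {P : Set} (P? : Dec P) → ⟦ P? ⟧ * ⟦ P? ⟧ ≡ ⟦ P? ⟧
      idempotent (yes _) = refl
      idempotent (no _) = refl
    common : ∀ g → + commonNbrs D D? g 0# ≡ ⟦ g ≟ᶠ 0# ⟧ * (k - μ) + d g * (λ′ - μ) + μ
    common g with g ≟ᶠ 0#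
    ... | yes refl = trans common-0 (trans
          (solve 3 (λ k l m → k := con 1ℤ :* (k :- m) :+ con 0ℤ :* (l :- m) :+ m) refl k λ′ μ)
          (cong (λ z → 1ℤ * (k - μ) + z * (λ′ - μ) + μ) (sym d-0)))
    ... | no g≢0 with D? g
    ...   | yes Dg = trans (adj g 0# g≢0 (subst D (sym (g-0 g)) Dg))
            (solve 3 (λ k l m → l := con 0ℤ :* (k :- m) :+ con 1ℤ :* (l :- m) :+ m) refl k λ′ μ)
    ...   | no ¬Dg = trans (nonadj g 0# g≢0 (¬Dg ∘ subst D (g-0 g)))
            (solve 3 (λ k l m → m := con 0ℤ :* (k :- m) :+ con 0ℤ :* (l :- m) :+ m) refl k λ′ μ)

  T : Carrier → Carrier → ℤ
  T v w = ∑ (λ x → Z v x * Z w x)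

  -- Within D, H_{v+w} coincides with H_v ∩ H_w, while all of H_v ∖ H_w lies in D.
  N₀-difference : ∀ v w →
    (∀ x → D x → Tr (v ⊗ x) ≢ 0# → Tr (w ⊗ x) ≡ 0#) →
    (∀ x → x ≢ 0# → ¬ D x → Tr (v ⊗ x) ≡ 0# → Tr (w ⊗ x) ≡ 0#) →
    N₀ v + T v w ≡ N₀ (v ⊕ w) + ∑ (Z v)
  N₀-difference v w on-D off-D = begin
    N₀ v + T v w                                       ≡⟨ cong (_+ T v w) (N₀≡ v) ⟩
    ∑ (λ x → d x * Z v x) + T v w                      ≡⟨ ∑-∙ _ _ ⟨
    ∑ (λ x → d x * Z v x + Z v x * Z w x)              ≡⟨ ∑-cong pointwise ⟩
    ∑ (λ x → d x * Z (v ⊕ w) x + Z v x)                ≡⟨ ∑-∙ _ _ ⟩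
    ∑ (λ x → d x * Z (v ⊕ w) x) + ∑ (Z v)              ≡⟨ cong (_+ ∑ (Z v)) (N₀≡ (v ⊕ w)) ⟨
    N₀ (v ⊕ w) + ∑ (Z v)                               ∎
    where
    open ≡-Reasoning
    pointwise : ∀ x → d x * Z v x + Z v x * Z w x ≡ d x * Z (v ⊕ w) x + Z v x
    pointwise x rewrite Tr-⊕ˡ v w x with D? x | Tr (v ⊗ x) ≟ᶠ 0# | Tr (w ⊗ x) ≟ᶠ 0#
    ... | yes Dx | yes v≡0 | yes w≡0 = sym (cong (λ z → 1ℤ * z + 1ℤ) (⟦⟧-yes (_ ≟ᶠ 0#) (trans
          (cong₂ _⊕_ v≡0 w≡0) (+-identityˡ 0#))))
    ... | yes Dx | yes v≡0 | no w≢0 = sym (cong (λ z → 1ℤ * z + 1ℤ) (⟦⟧-no (_ ≟ᶠ 0#) (λ eq → w≢0 (trans (sym (trans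
          (cong (_⊕ Tr (w ⊗ x)) v≡0) (+-identityˡ _))) eq))))
    ... | yes Dx | no v≢0 | yes w≡0 = sym (cong (λ z → 1ℤ * z + 0ℤ) (⟦⟧-no (_ ≟ᶠ 0#) (λ eq → v≢0 (trans (sym (trans
          (cong (Tr (v ⊗ x) ⊕_) w≡0) (+-identityʳ _))) eq))))
    ... | yes Dx | no v≢0 | no w≢0 = contradiction (on-D x Dx v≢0) w≢0
    ... | no ¬Dx | yes v≡0 | yes w≡0 = refl
    ... | no ¬Dx | no v≢0 | _ = refl
    ... | no ¬Dx | yes v≡0 | no w≢0 with x ≟ᶠ 0#
    ...   | yes refl = contradiction (trans (cong Tr (zeroʳ w)) Tr-0) w≢0
    ...   | no x≢0 = contradiction (off-D x x≢0 ¬Dx v≡0) w≢0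

  fD-yes : ∀ {x} → D x → fD D D? x ≡ 1#
  fD-yes {x} Dx with D? x
  ... | yes _ = refl
  ... | no ¬Dx = contradiction Dx ¬Dx

  fD-no : ∀ {x} → ¬ D x → fD D D? x ≡ 0#
  fD-no {x} ¬Dx with D? x
  ... | yes Dx = contradiction Dx ¬Dx
  ... | no _ = refl

  a⊕b≡0⇒a≢0 : ∀ {a b} → a ⊕ b ≡ 0# → b ≢ 0# → a ≢ 0#
  a⊕b≡0⇒a≢0 {b = b} a+b≡0 b≢0 a≡0 = b≢0 (trans (sym (+-identityˡ b)) (trans (cong (_⊕ b) (sym a≡0)) a+b≡0))

  Z-zero : ∀ x → Z 0# x ≡ 1ℤ
  Z-zero x = ⟦⟧-yes (_ ≟ᶠ 0#) (trans (cong Tr (zeroˡ x)) Tr-0)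

  N₀-zero : N₀ 0# ≡ ∑ d
  N₀-zero = trans (N₀≡ 0#) (∑-cong (λ x → trans (cong (d x *_) (Z-zero x)) (ℤ.*-identityʳ (d x))))

  -- One minus the indicators of D, of 0 and of x₁ is nowhere negative, since these three sets are
  -- disjoint; summing it over the field gives the bound.
  size-bound : (∃ λ x → x ≢ 0# × ¬ D x) → 0ℤ ℤ.≤ + size - ∑ d - + 2
  size-bound (x₁ , x₁≢0 , ¬Dx₁) = subst (0ℤ ℤ.≤_) total (∑-≥0 nonneg)
    where
    nonneg : ∀ x → 0ℤ ℤ.≤ 1ℤ + - 1ℤ * (d x + (⟦ x ≟ᶠ 0# ⟧ * 1ℤ + ⟦ x ≟ᶠ x₁ ⟧ * 1ℤ))
    nonneg x with D? x | x ≟ᶠ 0# | x ≟ᶠ x₁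
    ... | yes Dx | yes refl | _ = contradiction refl (D-nonzero _ Dx)
    ... | yes Dx | no _ | yes refl = contradiction Dx ¬Dx₁
    ... | yes _ | no _ | no _ = ℤ.≤-refl
    ... | no _ | yes refl | yes refl = contradiction refl x₁≢0
    ... | no _ | yes _ | no _ = ℤ.≤-refl
    ... | no _ | no _ | yes _ = ℤ.≤-refl
    ... | no _ | no _ | no _ = ℤ.+≤+ z≤n
    total : ∑ (λ x → 1ℤ + - 1ℤ * (d x + (⟦ x ≟ᶠ 0# ⟧ * 1ℤ + ⟦ x ≟ᶠ x₁ ⟧ * 1ℤ))) ≡ + size - ∑ d - + 2
    total = trans (∑-∙ _ _) (trans (cong₂ _+_ ∑-1 (trans (∑-*ˡ (- 1ℤ) _) (cong (- 1ℤ *_)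
      (trans (∑-∙ d _) (cong (_+_ (∑ d)) (trans (∑-∙ _ _) (cong₂ _+_ (∑-δ (λ _ → 1ℤ) 0#) (∑-δ (λ _ → 1ℤ) x₁))))))))
      (solve 2 (λ S k → S :+ con (- 1ℤ) :* (k :+ con (+ 2)) := S :- k :- con (+ 2)) refl (+ size) (∑ d)))

  -- Minimality of the code

  module Minimality {ε : ℤ} {s r : ℕ} (s²≡ : s ℕ.* s ≡ q ^ suc m-1)
      (1≤r : 1 ≤ r) (q<s : q < s) (q≡2⇒5≤s : q ≡ 2 → 5 ≤ s)
      (srg : IsSRG D D? (+ (q ^ suc m-1)) (Parameters.K ε (+ r) (+ s)) (Parameters.Λ ε (+ r) (+ s)) (Parameters.Μ ε (+ r) (+ s)))
      (admissible : Admissible ε q r s) where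
    open Parameters ε (+ r) (+ s)
    open Exclusions {ε} {q-1} {r} {s} 1≤r q<s

    private
      instance
        q-1-nonZero : ℕ.NonZero q-1
        q-1-nonZero = ℕ.>-nonZero (ℕ.≤-pred 2≤q)

    sgn : Sign ε
    sgn = [ inj₁ ∘ proj₁ , inj₂ ∘ proj₁ ]′ admissible

    ∑d≡K : ∑ d ≡ K
    ∑d≡K = trans (sym degree-0) (proj₁ (proj₂ (proj₂ (proj₂ (proj₂ (proj₂ srg))))) 0#)

    s²-ℤ : + (q ^ suc m-1) ≡ + s * + s
    s²-ℤ = trans (cong +_ (sym s²≡)) (ℤ.pos-* s s)

    q∑Z : ∀ {v} → v ≢ 0# → + q * ∑ (Z v) ≡ + s * + s
    q∑Z v≢0 = trans (|hyperplane| v≢0) s²-ℤ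

    qN₀-K : ∀ v → + q * N₀ v ≡ K + + q-1 * θ v
    qN₀-K v = trans (qN₀ v) (cong (_+ + q-1 * θ v) ∑d≡K)

    θ-eigenvalue : ∀ {v} → v ≢ 0# → Eigenvalue (θ v)
    θ-eigenvalue {v} v≢0 = eigenvalue (+ q-1) (ℕ.≢-nonZero⁻¹ q-1 ∘ ℤ.+-injective) sgn
      (trans (sym ∑d≡K) (|D|-by-fibres v))
      (trans (cong (λ k → N₀ v * N₀ v + (k - N₀ v) * N₁ v) (sym ∑d≡K)) (trans (sym (pairs v)) (pairs-srg srg v)))
      (q∑Z v≢0)

    cancel-q-1 : ∀ a b → + q-1 * a ≡ + q-1 * b → a ≡ b
    cancel-q-1 a b = ℤ.*-cancelˡ-≡ (+ q-1) a b

    -- The hypotheses are what the inclusion of supports amounts to when u ≠ 0 and u′ = 0. `search`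
    -- decides whether H_v lies in H_w: for v ≠ 0 and w ≠ 0 a witness against it makes v and w
    -- independent, and its absence makes w a multiple of v.
    separation : ∀ {v w} →
      (∀ x → D x → Tr (v ⊗ x) ≢ 0# → Tr (w ⊗ x) ≡ 0#) →
      (∀ x → x ≢ 0# → ¬ D x → Tr (v ⊗ x) ≡ 0# → Tr (w ⊗ x) ≡ 0#) →
      w ≡ 0#
    separation {v} {w} on-D off-D with w ≟ᶠ 0# | v ≟ᶠ 0# | search {P = λ x → Tr (v ⊗ x) ≡ 0# × Tr (w ⊗ x) ≢ 0#}
          (λ x → (_ ≟ᶠ 0#) ×-dec ¬? (_ ≟ᶠ 0#))
    ... | yes w≡0 | _ | _ = w≡0
    ... | no w≢0 | yes refl | _ =
          contradiction (cancel-q-1 _ _ (difference (N₀-difference 0# w on-D off-D)))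
                (complement⊄hyperplane admissible (θ-eigenvalue w≢0))
      where
      -- For v = 0 the set H_v is the whole field, so N₀(0) = K, T(0, w) = |H_w| = s²/q and |H_0| =
      -- s². Multiplying by q leaves a common factor q - 1.
      difference : N₀ 0# + T 0# w ≡ N₀ (0# ⊕ w) + ∑ (Z 0#) → + q-1 * (K - θ w) ≡ + q-1 * (+ s * + s)
      difference eq = trans
        (solve 3 (λ k t q′ → q′ :* (k :- t) := (con 1ℤ :+ q′) :* k :- (k :+ q′ :* t)) refl K (θ w) (+ q-1))
        (trans (cong₂ _-_ (cong (+ q *_) (sym (trans N₀-zero ∑d≡K))) (sym (qN₀-K w)))
        (trans (solve 5 (λ q′ a b t z → (con 1ℤ :+ q′) :* a :- (con 1ℤ :+ q′) :* b :=
                   (con 1ℤ :+ q′) :* (a :+ t) :- (con 1ℤ :+ q′) :* (b :+ z) :+ (con 1ℤ :+ q′) :* z :- (con 1ℤ :+ q′) :* t)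
                 refl (+ q-1) (N₀ 0#) (N₀ w) (T 0# w) (∑ (Z 0#)))
        (trans (cong₂ _-_ (cong₂ _+_ (ℤ.i≡j⇒i-j≡0 (cong (+ q *_) (trans eq (cong (λ u → N₀ u + ∑ (Z 0#)) (+-identityˡ w)))))
                                     (cong (+ q *_) ∑Z0))
                          (trans (cong (+ q *_) (∑-cong (λ x → trans (cong (_* Z w x) (Z-zero x))
                                (ℤ.*-identityˡ _)))) (q∑Z w≢0)))
          (solve 2 (λ q′ S → con 0ℤ :+ (con 1ℤ :+ q′) :* S :- S := q′ :* S) refl (+ q-1) (+ s * + s)))))
        where
        ∑Z0 : ∑ (Z 0#) ≡ + s * + s
        ∑Z0 = trans (∑-cong Z-zero) (trans ∑-1 (trans (cong +_ size≡) s²-ℤ))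
    ... | no w≢0 | no v≢0 | inj₁ (x₁ , v≡0 , w≢0′) =
          contradiction gap (eigenvalue-gap sgn (θ-eigenvalue v≢0) (θ-eigenvalue v⊕w≢0) (q∑Z v≢0))
      where
      v⊕w≢0 : v ⊕ w ≢ 0#
      v⊕w≢0 v⊕w≡0 = a⊕b≡0⇒a≢0 (trans (sym (Tr-⊕ˡ v w x₁)) (trans (cong (λ u → Tr (u ⊗ x₁)) v⊕w≡0) (trans
            (cong Tr (zeroˡ x₁)) Tr-0))) w≢0′ v≡0
      -- Since |H_v| = q |H_v ∩ H_w|, the set H_v without H_w has (q - 1)|H_v|/q elements;
      -- multiplied by q, this makes q - 1 cancel on both sides.
      gap : θ v - θ (v ⊕ w) ≡ ∑ (Z v)
      gap = cancel-q-1 _ _ (begin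
        + q-1 * (θ v - θ (v ⊕ w))
          ≡⟨ solve 4 (λ q′ k a b → q′ :* (a :- b) := (k :+ q′ :* a) :- (k :+ q′ :* b)) refl (+ q-1) K (θ v) (θ (v ⊕ w)) ⟩
        (K + + q-1 * θ v) - (K + + q-1 * θ (v ⊕ w))
          ≡⟨ cong₂ _-_ (qN₀-K v) (qN₀-K (v ⊕ w)) ⟨
        + q * N₀ v - + q * N₀ (v ⊕ w)
          ≡⟨ solve 5 (λ q a b t z → q :* a :- q :* b := (q :* (a :+ t) :- q :* (b :+ z)) :+ (q :* z :- q :* t))
                refl (+ q) (N₀ v) (N₀ (v ⊕ w)) (T v w) (∑ (Z v)) ⟩
        (+ q * (N₀ v + T v w) - + q * (N₀ (v ⊕ w) + ∑ (Z v))) + (+ q * ∑ (Z v) - + q * T v w)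
          ≡⟨ cong₂ _+_ (ℤ.i≡j⇒i-j≡0 (cong (+ q *_) (N₀-difference v w on-D off-D))) (cong (λ z → + q * ∑ (Z v) - z)
                (sym (|hyperplane∩| v≡0 w≢0′))) ⟩
        0ℤ + (+ q * ∑ (Z v) - ∑ (Z v))
          ≡⟨ solve 2 (λ q′ z → con 0ℤ :+ ((con 1ℤ :+ q′) :* z :- z) := q′ :* z) refl (+ q-1) (∑ (Z v)) ⟩
        + q-1 * ∑ (Z v) ∎)
        where open ≡-Reasoning
    ... | no w≢0 | no v≢0 | inj₂ none with proportional v≢0 (λ x v≡0 → decidable-stable (Tr (w ⊗ x) ≟ᶠ 0#)
          (λ w≢0 → none x (v≡0 , w≢0)))
    ...   | c , c∈ , refl = contradiction K≡θ (D⊄hyperplane admissible (θ-eigenvalue v≢0))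
      where
      c≢0 : c ≢ 0#
      c≢0 refl = w≢0 (zeroˡ v)
      D⊆ker : ∀ x → D x → Tr (v ⊗ x) ≡ 0#
      D⊆ker x Dx with Tr (v ⊗ x) ≟ᶠ 0#
      ... | yes v≡0 = v≡0
      ... | no v≢0 = no-zero-divisors c≢0 (trans (sym (Tr-⊗ˡ c v x c∈)) (on-D x Dx v≢0))
      N₀≡K : N₀ v ≡ K
      N₀≡K = trans (N₀≡ v) (trans (∑-cong (λ x → trans (⟦⟧-guard (D? x) (λ Dx → ⟦⟧-yes (_ ≟ᶠ 0#) (D⊆ker x Dx)))
            (ℤ.*-identityʳ (d x)))) ∑d≡K)
      K≡θ : K ≡ θ v
      K≡θ = cancel-q-1 _ _ (trans
        (solve 2 (λ q′ k → q′ :* k := (con 1ℤ :+ q′) :* k :- k) refl (+ q-1) K)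
        (trans (cong (_- K) (trans (cong (+ q *_) (sym N₀≡K)) (qN₀-K v)))
        (solve 3 (λ q′ k t → k :+ q′ :* t :- k := q′ :* t) refl (+ q-1) K (θ v))))

    D-meets-ker : ∀ {v} → v ≢ 0# → ∃ λ x → D x × Tr (v ⊗ x) ≡ 0#
    D-meets-ker {v} v≢0 with search {P = λ x → D x × Tr (v ⊗ x) ≡ 0#} (λ x → D? x ×-dec (_ ≟ᶠ 0#))
    ... | inj₁ found = found
    ... | inj₂ none = contradiction
          (trans (sym (qN₀-K v)) (trans (cong (+ q *_) N₀≡0) (ℤ.*-zeroʳ (+ q))))
          (D-meets-hyperplane admissible (θ-eigenvalue v≢0))
      where
      N₀≡0 : N₀ v ≡ 0ℤ
      N₀≡0 = trans (N₀≡ v) (trans (∑-cong (λ x → trans (⟦⟧-guard (D? x) (λ Dx → ⟦⟧-no (_ ≟ᶠ 0#)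
            (λ v≡0 → none x (Dx , v≡0)))) (ℤ.*-zeroʳ (d x)))) ∑-ε)

    -- With scalars 0 and 1 only, exactly one of v, w and v + w vanishes at each point of D, so
    -- their counts N₀ add up to |D|. Also H_v is the disjoint union of D ∩ H_v and H_v ∩ H_w, and
    -- the latter is half of H_v. Eliminating N₀(v) yields θ(w) + θ(v + w) = -|H_v|.
    D-nonlinear-on-ker : ∀ {v w} → v ≢ 0# →
      (∀ c → InFq c → c ≢ 0# → c ≡ 1#) →
      (∃ λ x → Tr (v ⊗ x) ≡ 0# × Tr (w ⊗ x) ≢ 0#) →
      (∀ x → D x → Tr (v ⊗ x) ≡ 0# → Tr (w ⊗ x) ≢ 0#) →
      (∀ x → x ≢ 0# → ¬ D x → Tr (v ⊗ x) ≡ 0# → Tr (w ⊗ x) ≡ 0#) → ⊥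
    D-nonlinear-on-ker {v} {w} v≢0 binary (x₀ , v≡0 , w≢0) on-D off-D =
      eigenvalue-sum admissible (q≡2⇒5≤s q≡2) (θ-eigenvalue w≢0#) (θ-eigenvalue v⊕w≢0) 2∑Z θ-sum
      where
      open ≡-Reasoning
      zero-trace : ∀ {u} x → u ≡ 0# → Tr (u ⊗ x) ≡ 0#
      zero-trace x refl = trans (cong Tr (zeroˡ x)) Tr-0
      w≢0# : w ≢ 0#
      w≢0# w≡0 = w≢0 (zero-trace x₀ w≡0)
      v⊕w≢0 : v ⊕ w ≢ 0#
      v⊕w≢0 v⊕w≡0 = a⊕b≡0⇒a≢0 (trans (sym (Tr-⊕ˡ v w x₀)) (zero-trace x₀ v⊕w≡0)) w≢0 v≡0
      φ-binary : ∀ a → φ a ≡ ⟦ a ≟ᶠ 0# ⟧ * 1ℤ + ⟦ a ≟ᶠ 1# ⟧ * 1ℤ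
      φ-binary a with a ≟ᶠ 0# | a ≟ᶠ 1#
      ... | yes refl | yes 0≡1 = contradiction 0≡1 0≢1
      ... | yes refl | no _ = ⟦⟧-yes (InFq? 0#) InFq-0
      ... | no _ | yes refl = ⟦⟧-yes (InFq? 1#) InFq-1
      ... | no a≢0 | no a≢1 = ⟦⟧-no (InFq? a) (λ a∈ → a≢1 (binary a a∈ a≢0))
      q≡2 : q ≡ 2
      q≡2 = ℤ.+-injective (trans (sym ∑φ≡q) (trans (∑-cong φ-binary) (trans (∑-∙ _ _)
        (cong₂ _+_ (∑-δ (λ _ → 1ℤ) 0#) (∑-δ (λ _ → 1ℤ) 1#)))))
      q-ℤ : + q ≡ + 2
      q-ℤ = cong +_ q≡2
      2∑Z : + 2 * ∑ (Z v) ≡ + s * + s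
      2∑Z = trans (cong (_* ∑ (Z v)) (sym q-ℤ)) (q∑Z v≢0)
      -- -1 is a nonzero element of F_q, so `binary` identifies it with 1.
      1⊕1≡0 : 1# ⊕ 1# ≡ 0#
      1⊕1≡0 = trans (cong (1# ⊕_) (sym (binary (⊖ 1#) (InFq-⊖ InFq-1)
        (λ -1≡0 → 0≢1 (trans (sym (-‿inverseʳ 1#)) (trans (cong (1# ⊕_) -1≡0) (+-identityʳ 1#))))))) (-‿inverseʳ 1#)
      value-1 : ∀ u x → Tr (u ⊗ x) ≢ 0# → Tr (u ⊗ x) ≡ 1#
      value-1 u x = binary _ (Tr-InFq _)
      split-D : ∀ x → d x * Z w x + d x * Z (v ⊕ w) x + d x * Z v x ≡ d x
      split-D x rewrite Tr-⊕ˡ v w x with D? x | Tr (v ⊗ x) ≟ᶠ 0# | Tr (w ⊗ x) ≟ᶠ 0#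
      ... | no _ | _ | _ = refl
      ... | yes Dx | yes v≡0 | yes w≡0 = contradiction w≡0 (on-D x Dx v≡0)
      ... | yes Dx | yes v≡0 | no w≢0 = cong (λ z → 0ℤ + 1ℤ * z + 1ℤ) (⟦⟧-no (_ ≟ᶠ 0#)
            (λ eq → w≢0 (trans (sym (trans (cong (_⊕ Tr (w ⊗ x)) v≡0) (+-identityˡ _))) eq)))
      ... | yes Dx | no v≢0 | yes w≡0 = cong (λ z → 1ℤ + 1ℤ * z + 0ℤ) (⟦⟧-no (_ ≟ᶠ 0#)
            (λ eq → v≢0 (trans (sym (trans (cong (Tr (v ⊗ x) ⊕_) w≡0) (+-identityʳ _))) eq)))
      ... | yes Dx | no v≢0 | no w≢0 = cong (λ z → 0ℤ + 1ℤ * z + 0ℤ) (⟦⟧-yes (_ ≟ᶠ 0#)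
            (trans (cong₂ _⊕_ (value-1 v x v≢0) (value-1 w x w≢0)) 1⊕1≡0))
      split-ker : ∀ x → d x * Z v x + Z v x * Z w x ≡ Z v x
      split-ker x with D? x | Tr (v ⊗ x) ≟ᶠ 0# | Tr (w ⊗ x) ≟ᶠ 0#
      ... | yes Dx | yes v≡0 | yes w≡0 = contradiction w≡0 (on-D x Dx v≡0)
      ... | yes Dx | yes v≡0 | no _ = refl
      ... | yes Dx | no _ | _ = refl
      ... | no ¬Dx | no _ | _ = refl
      ... | no ¬Dx | yes v≡0 | yes _ = refl
      ... | no ¬Dx | yes v≡0 | no w≢0 with x ≟ᶠ 0#
      ...   | yes refl = contradiction (trans (cong Tr (zeroʳ w)) Tr-0) w≢0
      ...   | no x≢0 = contradiction (off-D x x≢0 ¬Dx v≡0) w≢0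
      N₀-sum : N₀ w + N₀ (v ⊕ w) + N₀ v ≡ K
      N₀-sum = begin
        N₀ w + N₀ (v ⊕ w) + N₀ v  ≡⟨ cong₂ _+_ (cong₂ _+_ (N₀≡ w) (N₀≡ (v ⊕ w))) (N₀≡ v) ⟩
        _                          ≡⟨ trans (∑-∙ _ _) (cong (_+ ∑ (λ x → d x * Z v x)) (∑-∙ _ _)) ⟨
        ∑ (λ x → d x * Z w x + d x * Z (v ⊕ w) x + d x * Z v x) ≡⟨ ∑-cong split-D ⟩
        ∑ d                        ≡⟨ ∑d≡K ⟩
        K                          ∎
      N₀+T : N₀ v + T v w ≡ ∑ (Z v)
      N₀+T = trans (cong (_+ T v w) (N₀≡ v)) (trans (sym (∑-∙ _ _)) (∑-cong split-ker))
      2T : ∑ (Z v) ≡ + 2 * T v w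
      2T = trans (|hyperplane∩| v≡0 w≢0) (cong (_* T v w) q-ℤ)
      2N₀ : ∀ u → + 2 * N₀ u ≡ K + θ u
      2N₀ u = trans (cong (_* N₀ u) (sym q-ℤ)) (trans (qN₀-K u) (cong (_+_ K) (trans (cong (λ n → + n * θ u)
            (ℕ.suc-injective q≡2)) (ℤ.*-identityˡ _))))
      θ-sum : θ w + θ (v ⊕ w) ≡ - ∑ (Z v)
      θ-sum = begin
        θ w + θ (v ⊕ w)
          ≡⟨ solve 3 (λ k a b → a :+ b := (k :+ a) :+ (k :+ b) :- con (+ 2) :* k) refl K (θ w) (θ (v ⊕ w)) ⟩
        (K + θ w) + (K + θ (v ⊕ w)) - + 2 * K
          ≡⟨ cong₂ _-_ (cong₂ _+_ (2N₀ w) (2N₀ (v ⊕ w))) (cong (+ 2 *_) N₀-sum) ⟨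
        + 2 * N₀ w + + 2 * N₀ (v ⊕ w) - + 2 * (N₀ w + N₀ (v ⊕ w) + N₀ v)
          ≡⟨ solve 4 (λ a b c t → con (+ 2) :* a :+ con (+ 2) :* b :- con (+ 2) :* (a :+ b :+ c) := con (+ 2) :* t :- con (+ 2) :* (c :+ t)) refl (N₀ w) (N₀ (v ⊕ w)) (N₀ v) (T v w) ⟩
        + 2 * T v w - + 2 * (N₀ v + T v w)
          ≡⟨ cong₂ _-_ (sym 2T) (cong (+ 2 *_) N₀+T) ⟩
        ∑ (Z v) - + 2 * ∑ (Z v)
          ≡⟨ solve 1 (λ z → z :- con (+ 2) :* z := :- z) refl (∑ (Z v)) ⟩
        - ∑ (Z v) ∎

    minimal : IsMinimalCode D D?
    minimal u v u′ v′ u∈ u′∈ supp with u ≟ᶠ 0#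
    ... | no u≢0 = c , c∈ , λ x _ → trans (combination x) (trans (cong (λ z → c ⊗ cw D D? u v x ⊕ Tr (z ⊗ x)) w≡0)
                     (trans (cong (c ⊗ cw D D? u v x ⊕_) (trans (cong Tr (zeroˡ x)) Tr-0)) (+-identityʳ _)))
      where
      open ≡-Reasoning
      c w : Carrier
      c = u ⁻¹ ⊗ u′
      w = v′ ⊕ ⊖ c ⊗ v
      c∈ : InFq c
      c∈ = InFq-⊗ (InFq-⁻¹ u≢0 u∈) u′∈
      combination : ∀ x → cw D D? u′ v′ x ≡ c ⊗ cw D D? u v x ⊕ Tr (w ⊗ x)
      combination x = begin
        u′ ⊗ f ⊕ t′
          ≡⟨ cong₂ _⊕_ (cong (_⊗ f) (⊗⁻¹-cancel u′ u≢0)) (+-identityʳ t′) ⟨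
        u ⊗ c ⊗ f ⊕ (t′ ⊕ 0#)
          ≡⟨ cong (λ z → u ⊗ c ⊗ f ⊕ (t′ ⊕ z)) (trans (sym (distribʳ t c (⊖ c))) (trans
                (cong (_⊗ t) (-‿inverseʳ c)) (zeroˡ t))) ⟨
        u ⊗ c ⊗ f ⊕ (t′ ⊕ (c ⊗ t ⊕ ⊖ c ⊗ t))
          ≡⟨ FS.solve 6 (λ u c -c f t t′ → u FS.:* c FS.:* f FS.:+ (t′ FS.:+ (c FS.:* t FS.:+ -c FS.:* t)) FS.:=
                c FS.:* (u FS.:* f FS.:+ t) FS.:+ (t′ FS.:+ -c FS.:* t)) refl u c (⊖ c) f t t′ ⟩
        c ⊗ (u ⊗ f ⊕ t) ⊕ (t′ ⊕ ⊖ c ⊗ t)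
          ≡⟨ cong (c ⊗ (u ⊗ f ⊕ t) ⊕_) (trans (Tr-⊕ˡ v′ _ x) (cong (t′ ⊕_) (Tr-⊗ˡ (⊖ c) v x (InFq-⊖ c∈)))) ⟨
        c ⊗ (u ⊗ f ⊕ t) ⊕ Tr (w ⊗ x) ∎
        where
        f t t′ : Carrier
        f = fD D D? x
        t = Tr (v ⊗ x)
        t′ = Tr (v′ ⊗ x)
      zeros : ∀ x → x ≢ 0# → cw D D? u v x ≡ 0# → Tr (w ⊗ x) ≡ 0#
      zeros x x≢0 cw≡0 = begin
        Tr (w ⊗ x)                          ≡⟨ +-identityˡ _ ⟨
        0# ⊕ Tr (w ⊗ x)                     ≡⟨ cong (_⊕ Tr (w ⊗ x)) (trans (cong (c ⊗_) cw≡0) (zeroʳ c)) ⟨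
        c ⊗ cw D D? u v x ⊕ Tr (w ⊗ x)      ≡⟨ combination x ⟨
        cw D D? u′ v′ x                     ≡⟨ vanish x x≢0 cw≡0 ⟩
        0#                                  ∎
        where
        vanish : ∀ x → x ≢ 0# → cw D D? u v x ≡ 0# → cw D D? u′ v′ x ≡ 0#
        vanish x x≢0 cw≡0 = decidable-stable (_ ≟ᶠ 0#) (λ cw′≢0 → supp x x≢0 cw′≢0 cw≡0)
      on-D : ∀ x → D x → Tr (v ⊗ x) ≢ 0# → Tr (w ⊗ x) ≡ 0#
      on-D x Dx t≢0 = no-zero-divisors a≢0 (trans (sym (Tr-scale w a x a∈))
        (zeros (a ⊗ x) (⊗-≢0 a≢0 (D-nonzero x Dx)) (begin
          u ⊗ fD D D? (a ⊗ x) ⊕ Tr (v ⊗ (a ⊗ x))     ≡⟨ cong₂ _⊕_ (trans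
                (cong (u ⊗_) (fD-yes (proj₁ (D-invariant a a∈ a≢0 x) Dx))) (*-identityʳ u)) (Tr-scale v a x a∈) ⟩
          u ⊕ ⊖ u ⊗ t ⁻¹ ⊗ t                          ≡⟨ cong (u ⊕_) (trans (*-assoc (⊖ u) _ t) (trans
                (cong (⊖ u ⊗_) (⁻¹-inverseˡ t≢0)) (*-identityʳ _))) ⟩
          u ⊕ ⊖ u                                     ≡⟨ -‿inverseʳ u ⟩
          0#                                          ∎)))
        where
        t a : Carrier
        t = Tr (v ⊗ x)
        -- The scalar for which c(u,v) vanishes at ax: `f_D(ax)` is still 1 by invariance of D, and
        -- Tr(v a x) = -u.
        a = ⊖ u ⊗ t ⁻¹
        a∈ : InFq a
        a∈ = InFq-⊗ (InFq-⊖ u∈) (InFq-⁻¹ t≢0 (Tr-InFq _))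
        a≢0 : a ≢ 0#
        a≢0 = ⊗-≢0 (a⊕b≡0⇒a≢0 (-‿inverseˡ u) u≢0) (⁻¹-≢0 t≢0)
      off-D : ∀ x → x ≢ 0# → ¬ D x → Tr (v ⊗ x) ≡ 0# → Tr (w ⊗ x) ≡ 0#
      off-D x x≢0 ¬Dx t≡0 = zeros x x≢0 (trans (cong₂ _⊕_ (trans (cong (u ⊗_) (fD-no ¬Dx)) (zeroʳ u)) t≡0) (+-identityˡ 0#))
      w≡0 : w ≡ 0#
      w≡0 = separation on-D off-D
    ... | yes refl with v ≟ᶠ 0#
    ...   | yes refl = 0# , InFq-0 , λ x x≢0 → trans
            (decidable-stable (_ ≟ᶠ 0#) (λ cw′≢0 → supp x x≢0 cw′≢0 (trans (cong₂ _⊕_ (zeroˡ _) (trans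
                  (cong Tr (zeroˡ x)) Tr-0)) (+-identityˡ 0#))))
            (sym (zeroˡ _))
    ...   | no v≢0 = linear
      where
      zeros : ∀ x → x ≢ 0# → Tr (v ⊗ x) ≡ 0# → u′ ⊗ fD D D? x ⊕ Tr (v′ ⊗ x) ≡ 0#
      zeros x x≢0 t≡0 = decidable-stable (_ ≟ᶠ 0#) (λ cw′≢0 → supp x x≢0 cw′≢0 (trans
            (cong₂ _⊕_ (zeroˡ _) t≡0) (+-identityˡ 0#)))
      off-D : ∀ x → x ≢ 0# → ¬ D x → Tr (v ⊗ x) ≡ 0# → Tr (v′ ⊗ x) ≡ 0#
      off-D x x≢0 ¬Dx t≡0 = trans (sym (trans (cong (_⊕ Tr (v′ ⊗ x)) (trans
            (cong (u′ ⊗_) (fD-no ¬Dx)) (zeroʳ u′))) (+-identityˡ _))) (zeros x x≢0 t≡0)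
      on-D : ∀ x → D x → Tr (v ⊗ x) ≡ 0# → u′ ⊕ Tr (v′ ⊗ x) ≡ 0#
      on-D x Dx t≡0 = trans (cong (_⊕ Tr (v′ ⊗ x)) (sym (trans (cong (u′ ⊗_) (fD-yes Dx)) (*-identityʳ u′))))
            (zeros x (D-nonzero x Dx) t≡0)
      u′≡0 : u′ ≡ 0#
      u′≡0 with u′ ≟ᶠ 0#
      ... | yes u′≡0 = u′≡0
      ... | no u′≢0 with D-meets-ker v≢0
      ...   | x₀ , Dx₀ , t₀≡0 = ⊥-elim (D-nonlinear-on-ker v≢0 binary (x₀ , t₀≡0 , nonzero x₀ Dx₀ t₀≡0) nonzero off-D)
        where
        nonzero : ∀ x → D x → Tr (v ⊗ x) ≡ 0# → Tr (v′ ⊗ x) ≢ 0#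
        nonzero x Dx t≡0 t′≡0 = a⊕b≡0⇒a≢0 (trans (+-comm _ _) (on-D x Dx t≡0)) u′≢0 t′≡0
        -- On D ∩ H_v the value Tr(v′x) is forced to be -u′. Both x₀ and c x₀ lie there, so c t′ =
        -- t′ with t′ ≠ 0.
        binary : ∀ c → InFq c → c ≢ 0# → c ≡ 1#
        binary c c∈ c≢0 = begin
          c                                          ≡⟨ *-identityʳ c ⟨
          c ⊗ 1#                                     ≡⟨ cong (c ⊗_) (⁻¹-inverseʳ t′≢0) ⟨
          c ⊗ (t′ ⊗ t′ ⁻¹)                           ≡⟨ *-assoc c t′ _ ⟨
          c ⊗ t′ ⊗ t′ ⁻¹                             ≡⟨ cong (_⊗ t′ ⁻¹) (⊕-cancelˡ u′ (trans (trans (cong (u′ ⊕_) (sym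
                (Tr-scale v′ c x₀ c∈))) (on-D (c ⊗ x₀) (proj₁ (D-invariant c c∈ c≢0 x₀) Dx₀) (trans (Tr-scale v c x₀ c∈)
                (trans (cong (c ⊗_) t₀≡0) (zeroʳ c))))) (sym (on-D x₀ Dx₀ t₀≡0)))) ⟩
          t′ ⊗ t′ ⁻¹                                 ≡⟨ ⁻¹-inverseʳ t′≢0 ⟩
          1#                                         ∎
          where
          open ≡-Reasoning
          t′ : Carrier
          t′ = Tr (v′ ⊗ x₀)
          t′≢0 : t′ ≢ 0#
          t′≢0 = nonzero x₀ Dx₀ t₀≡0
      ker⊆ : ∀ x → Tr (v ⊗ x) ≡ 0# → Tr (v′ ⊗ x) ≡ 0#
      ker⊆ x t≡0 with x ≟ᶠ 0#
      ... | yes refl = trans (cong Tr (zeroʳ v′)) Tr-0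
      ... | no x≢0 = trans (sym (trans (cong (_⊕ Tr (v′ ⊗ x)) (trans
            (cong (_⊗ fD D D? x) u′≡0) (zeroˡ _))) (+-identityˡ _))) (zeros x x≢0 t≡0)
      linear : Σ Carrier λ c → InFq c × (∀ x → x ≢ 0# → cw D D? u′ v′ x ≡ c ⊗ cw D D? 0# v x)
      linear with proportional v≢0 ker⊆
      ... | c , c∈ , v′≡cv = c , c∈ , λ x _ → begin
        u′ ⊗ fD D D? x ⊕ Tr (v′ ⊗ x)          ≡⟨ cong₂ _⊕_ (trans (cong (_⊗ fD D D? x) u′≡0) (zeroˡ _)) (trans (cong
              (λ z → Tr (z ⊗ x)) v′≡cv) (Tr-⊗ˡ c v x c∈)) ⟩
        0# ⊕ c ⊗ Tr (v ⊗ x)                   ≡⟨ +-identityˡ _ ⟩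
        c ⊗ Tr (v ⊗ x)                        ≡⟨ cong (c ⊗_) (trans (cong (_⊕ Tr (v ⊗ x)) (zeroˡ _)) (+-identityˡ _)) ⟨
        c ⊗ (0# ⊗ fD D D? x ⊕ Tr (v ⊗ x))     ∎
        where open ≡-Reasoning

minimal-code : ∀ (L : FiniteField) (q m : ℕ) → 2 ≤ q → 4 ≤ m → ¬ (m ≡ 4 × q ≡ 2) →
  (∀ x y → FiniteField._^_ L (FiniteField._+_ L x y) q
           ≡ FiniteField._+_ L (FiniteField._^_ L x q) (FiniteField._^_ L y q)) →
  FiniteField.size L ≡ q ^ m →
  ∀ {ε r s} → s ℕ.* s ≡ q ^ m → 1 ≤ r →
  (D : Pred (FiniteField.Carrier L) 0ℓ) (D? : ∀ x → Dec (D x)) →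
  (∃ λ x → x ≢ FiniteField.0# L × ¬ D x) →
  Setting.FqInvariant L q m D D? →
  Setting.IsPDS L q m D D? (+ (q ^ m))
    (Parameters.K ε (+ r) (+ s)) (Parameters.Λ ε (+ r) (+ s)) (Parameters.Μ ε (+ r) (+ s)) →
  (ε ≡ + 1 × r ≢ s × 1 < r) ⊎ (ε ≡ - + 1 × r ≢ s ∸ 1 × (q ∸ 1) ℕ.* s < r ℕ.* (s ℕ.+ q)) →
  Setting.IsMinimalCode L q m D D?
minimal-code L q@(suc q-1) m@(suc m-1) 2≤q 4≤m [m,q]≢[4,2] frob size≡ {ε} {r} {s} s²≡ 1≤r
  D D? proper D-invariant (D-nonzero , _ , srg@(_ , _ , _ , _ , _ , regular , _)) cond =
  Minimality.minimal s²≡ 1≤r q<s q≡2⇒5≤s srg (r-bound q r s (ℕ.≤-trans 2≤q (ℕ.<⇒≤ q<s)) bound cond)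
  where
  open DifferenceSet L q-1 m-1 2≤q size≡ frob D D? D-invariant D-nonzero
  open ℕ.≤-Reasoning
  -- s ≤ q would give q^m = s² ≤ q², against m > 2.
  q<s : q < s
  q<s = ℕ.≰⇒> λ s≤q → ℕ.<-irrefl s²≡ (begin-strict
    s ℕ.* s    ≤⟨ ℕ.*-mono-≤ s≤q s≤q ⟩
    q ℕ.* q    ≡⟨ cong (q ℕ.*_) (ℕ.*-identityʳ q) ⟨
    q ^ 2      <⟨ ℕ.^-monoʳ-< q 2≤q (ℕ.≤-trans (s≤s (s≤s (s≤s z≤n))) 4≤m) ⟩
    q ^ m      ∎)
  -- For q = 2 the excluded pair leaves m > 4, so s² > 16; `eigenvalue-sum` uses this as 4s < s².
  q≡2⇒5≤s : q ≡ 2 → 5 ≤ s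
  q≡2⇒5≤s q≡2 = ℕ.≰⇒> λ s≤4 → ℕ.<-irrefl s²≡ (begin-strict
    s ℕ.* s    ≤⟨ ℕ.*-mono-≤ s≤4 s≤4 ⟩
    2 ^ 4      <⟨ ℕ.^-monoʳ-< 2 ℕ.≤-refl (ℕ.≤∧≢⇒< 4≤m (λ 4≡m → [m,q]≢[4,2] (sym 4≡m , q≡2))) ⟩
    2 ^ m      ≡⟨ cong (_^ m) q≡2 ⟨
    q ^ m      ∎)
  bound : 0ℤ ℤ.≤ + s * + s - Parameters.K ε (+ r) (+ s) - + 2
  bound = subst (0ℤ ℤ.≤_) (cong₂ (λ a b → a - b - + 2)
    (trans (cong +_ (trans size≡ (sym s²≡))) (ℤ.pos-* s s))
    (trans (sym degree-0) (regular (FiniteField.0# L)))) (size-bound proper)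

theorem5 : (p e m : ℕ) → Prime p → 1 ≤ e → 4 ≤ m →
    ¬ (m ≡ 4 × p ^ e ≡ 2) → 2 ∣ e Data.Nat.* m →
    (L : FiniteField) → FiniteField.size L ≡ (p ^ e) ^ m →
    (s : ℕ) → s Data.Nat.* s ≡ (p ^ e) ^ m →
    (ε : ℤ) → (ε ≡ + 1 ⊎ ε ≡ - + 1) →
    (r : ℕ) → 1 ≤ r →
    (D : Pred (FiniteField.Carrier L) 0ℓ) → (D? : ∀ x → Dec (D x)) →
    (∃ λ x → x ≢ FiniteField.0# L × ¬ D x) →
    Setting.FqInvariant L (p ^ e) m D D? →
    Setting.IsPDS L (p ^ e) m D D?
    (+ ((p ^ e) ^ m))
    (+ r Data.Integer.* (+ s Data.Integer.- ε))
    (ε Data.Integer.* + s Data.Integer.+ + r Data.Integer.* + r Data.Integer.- + 3 Data.Integer.* ε Data.Integer.* + r)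
    (+ r Data.Integer.* + r Data.Integer.- ε Data.Integer.* + r) →
    ((ε ≡ + 1 × r ≢ s × 1 < r) ⊎
    (ε ≡ - + 1 × r ≢ s ∸ 1 × (p ^ e ∸ 1) Data.Nat.* s < r Data.Nat.* (s Data.Nat.+ p ^ e))) →
    Setting.IsMinimalCode L (p ^ e) m D D?
theorem5 p e m prime-p 1≤e 4≤m [m,q]≢[4,2] _ L size≡ s s²≡ ε _ r 1≤r =
  minimal-code L (p ^ e) m 2≤q 4≤m [m,q]≢[4,2] (frobenius e) size≡ s²≡ 1≤r
  where
  open FieldProperties L
  -- The field has p^(em) elements, so p · 1 = 0, which makes x ↦ x^(p^e) additive.
  open Characteristic prime-p (characteristic p (e ℕ.* m) (trans size≡ (ℕ.^-*-assoc p e m)))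
  2≤p : 2 ≤ p
  2≤p = ℕ.nonTrivial⇒n>1 p {{prime⇒nonTrivial prime-p}}
  2≤q : 2 ≤ p ^ e
  2≤q = ℕ.^-monoʳ-< p 2≤p 1≤e
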